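{- Let $k\geq 0$ and $t\geq 2$ be integers and let $T$ be a tournament with $n$ vertices and irregularity $i(T)\leq k$. If $n\geq 6t+5k-3$, then $\kappa_{w}^{*}(T)\geq t+1$; that is, $T$ is $\omega^{*}$-weakly connected for every $1\leq\omega\leq t+1$.
   Context: A tournament is a digraph in which each pair of distinct vertices is joined by exactly one arc. The irregularity $i(T)$ of a tournament $T$ is $\max_{x\in V(T)}|d^{+}(x)-d^{ - }(x)|$, where $d^{+},d^{ - }$ denote out- and in-degree. For distinct vertices $u,v$ of a digraph $D$, a weak $k^{*}$-container between $u$ and $v$ is a set of $k$ internally disjoint paths, each of which is either a $(u,v)$-path or a $(v,u)$-path (different paths may have different directions), whose union contains every vertex of $D$. $D$ is $k^{*}$-weakly connected if there is a weak $k^{*}$-container between every two distinct vertices of $D$. If $D$ is $1^{*}$-weakly connected, the weak spanning connectivity $\kappa_{w}^{*}(D)$ is the largest integer $k$ such that $D$ is $\omega^{*}$-weakly connected for all $1\leq\omega\leq k$. -}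

module Defs where

open import Data.Fin.Base using (Fin)
open import Data.List.Base using (List; allFin; filter; head; last; length; map)
open import Data.List.Extrema.Nat using (max)
open import Data.List.Membership.Propositional using (_∈_)
open import Data.List.Relation.Unary.Linked using (Linked)
open import Data.List.Relation.Unary.Unique.Propositional using (Unique)
open import Data.Maybe.Base using (just)
open import Data.Nat.Base using (ℕ; _≤_; ∣_-_∣)
open import Data.Product.Base using (∃-syntax; _×_)
open import Data.Sum.Base using (_⊎_)
open import Function.Definitions using (Injective)
open import Level using (0ℓ)
open import Relation.Binary.Core using (Rel)
open import Relation.Binary.Definitions using (Decidable)
open import Relation.Binary.PropositionalEquality.Core using (_≡_; _≢_)
open import Relation.Nullary.Negation.Core using (¬_)

record Digraph (n : ℕ) : Set₁ where
  infix 4 _⟶_ _⟶?_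
  field
    _⟶_      : Rel (Fin n) 0ℓ
    _⟶?_     : Decidable _⟶_
    loopless : ∀ x → ¬ (x ⟶ x)

  outdeg : Fin n → ℕ
  outdeg x = length (filter (λ y → x ⟶? y) (allFin n))

  indeg : Fin n → ℕ
  indeg x = length (filter (λ y → y ⟶? x) (allFin n))

  -- The base value 0 of the maximum matters only when n = 0.
  irregularity : ℕ
  irregularity = max 0 (map (λ x → ∣ outdeg x - indeg x ∣) (allFin n))

  IsTournament : Set
  IsTournament = ∀ x y → x ≢ y →
    (x ⟶ y × ¬ (y ⟶ x)) ⊎ (y ⟶ x × ¬ (x ⟶ y))

  -- A path is the list of its vertices, both ends included.
  record IsPath (u v : Fin n) (p : List (Fin n)) : Set where
    field
      starts : head p ≡ just u
      ends   : last p ≡ just v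
      arcs   : Linked _⟶_ p
      simple : Unique p

  record WeakContainer (k : ℕ) (u v : Fin n) : Set where
    field
      path     : Fin k → List (Fin n)
      isPath   : ∀ i → IsPath u v (path i) ⊎ IsPath v u (path i)
      -- A container is a set of k paths. Disjointness alone would allow a
      -- single arc between u and v to be repeated.
      distinct : Injective _≡_ _≡_ path
      disjoint : ∀ i j → i ≢ j → ∀ x → x ∈ path i → x ∈ path j → x ≡ u ⊎ x ≡ v
      spanning : ∀ x → ∃[ i ] x ∈ path i

  WeaklyConnected : ℕ → Set
  WeaklyConnected k = ∀ u v → u ≢ v → WeakContainer k u v

  WeaklyConnectedUpTo : ℕ → Set
  WeaklyConnectedUpTo k = ∀ ω → 1 ≤ ω → ω ≤ k → WeaklyConnected ω

  -- "κ is the weak spanning connectivity". It is a relation because the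
  -- invariant is defined only for 1*-weakly connected digraphs.
  record IsWeakSpanningConnectivity (κ : ℕ) : Set where
    field
      connected₁ : WeaklyConnected 1
      connected  : WeaklyConnectedUpTo κ
      largest    : ∀ m → WeaklyConnectedUpTo m → m ≤ κ

{-# OPTIONS --safe #-}
-- A vertex x outside a path fits between two consecutive vertices of it unless,
-- along the path, arcs into x are never followed by arcs out of x. So, given
-- internally disjoint paths between u and v, a vertex outside them fits into one
-- of them, or dominates all of them, or is dominated by all of them; the only
-- other possibility is that all paths run from s to e, say, and e → x → s. Since T
-- is strong, vertices of the second and third kind are joined by an arc in the
-- direction that lets this arc fit into a path. Hence, for ω ≥ 2, it suffices to
-- find ω internally disjoint paths, running in both directions unless no x as
-- above exists. The arc between u and v and greedily chosen paths with at most two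
-- inner vertices do: were the greedy choice to stop, there would be large sets A
-- and B with all arcs from B to A, and averaging degrees inside A and B shows that
-- this contradicts the bound on the irregularity.
--
-- For ω = 1, the same absorption argument gives a Hamiltonian cycle a₀ a₁ a₂ … of
-- T − {u, v}. If cutting it open never yields a path that can be completed by u
-- and v, then its vertices alternate between u → a → v and v → a → u. Removing a₁
-- (or a₂) and inserting it elsewhere gives a path with equal types at both ends; if
-- neither can be inserted, then a₁ → a₃ and a₂ → a₅, and a₂ a₅ … a₀ a₁ a₃ a₄ is
-- such a path.
--
-- That κ exists constructively needs WeaklyConnected to be decidable, which is
-- shown by enumerating families of simple paths.

module Submission where

open import Data.Bool.Base using (Bool; true; false; not)
open import Data.Empty using (⊥; ⊥-elim)
open import Data.Fin.Base using (Fin; zero; suc)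
open import Data.Fin.Properties using (_≟_; all?; any?)
open import Data.List.Base using (List; []; _∷_; [_]; _++_; allFin; cartesianProductWith; concat; filter; head; last; length; lookup; map)
open import Data.List.Extrema.Nat using (xs≤max)
import Data.List.Membership.DecPropositional as DecMembership
open import Data.List.Membership.Propositional using (_∈_; _∉_; find; lose)
open import Data.List.Membership.Propositional.Properties
open import Data.List.Properties as List using (length-++; length-tabulate; ++-assoc; ++-identityʳ)
open import Data.List.Relation.Binary.Disjoint.Propositional using (Disjoint)
open import Data.List.Relation.Binary.Permutation.Propositional using (_↭_; ↭-refl; ↭-sym; ↭-trans; ↭-prep; ↭-swap; ↭-reflexive; ↭⇒↭ₛ)
open import Data.List.Relation.Binary.Permutation.Propositional.Properties using (↭-length; All-resp-↭; ∈-resp-↭; ++⁺ˡ; ++⁺ʳ; ++-comm; shifts)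
import Data.List.Relation.Binary.Permutation.Setoid.Properties as Permutation
open import Data.List.Relation.Binary.Pointwise as Pointwise using (Pointwise; []; _∷_)
open import Data.List.Relation.Binary.Subset.Propositional using (_⊆_)
open import Data.List.Relation.Unary.All as All using (All; []; _∷_)
import Data.List.Relation.Unary.All.Properties as All
open import Data.List.Relation.Unary.AllPairs as AllPairs using ([]; _∷_)
open import Data.List.Relation.Unary.Any as Any using (Any; here; there)
open import Data.List.Relation.Unary.Any.Properties using (lookup-index)
open import Data.List.Relation.Unary.Linked as Linked using (Linked; []; [-]; _∷_; linked?)
import Data.List.Relation.Unary.Unique.DecPropositional as DecUnique
open import Data.List.Relation.Unary.Unique.Propositional using (Unique)
import Data.List.Relation.Unary.Unique.Propositional.Properties as Unique
open import Data.Maybe.Base using (just)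
import Data.Maybe.Properties as Maybe
open import Data.Nat.Base using (ℕ; zero; suc; _+_; _*_; _∸_; _≤_; _<_; _≥_; z≤n; s≤s; s≤s⁻¹; ∣_-_∣)
open import Data.Nat.ListAction using (sum)
open import Data.Nat.Properties hiding (_≟_)
open import Data.Nat.Tactic.RingSolver using (solve-∀)
open import Data.Product.Base using (∃-syntax; _×_; _,_; proj₁; proj₂)
open import Data.Sum.Base using (_⊎_; inj₁; inj₂)
import Data.Vec.Functional as Functional
open import Function.Base using (_∘_; flip)
open import Relation.Binary.PropositionalEquality using (_≡_; _≢_; _≗_; refl; sym; trans; cong; cong₂; subst; setoid)
open import Relation.Nullary using (¬_; Dec; yes; no; ¬?; _×-dec_; _⊎-dec_; _→-dec_)
open import Relation.Nullary.Decidable using (decidable-stable; map′)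
open import Relation.Unary using (Decidable)
open import Defs

-- Lists: counting, linked lists and uniqueness

module _ {A : Set} where

  length-⊆ : ∀ {xs ys : List A} → Unique xs → xs ⊆ ys → length xs ≤ length ys
  length-⊆ {[]} _ _ = z≤n
  length-⊆ {x ∷ xs} (x≢ ∷ uniq) xs⊆ys with ∈-∃++ (xs⊆ys (here refl))
  ... | ls , rs , refl = begin
    suc (length xs)              ≤⟨ s≤s (length-⊆ uniq avoid) ⟩
    suc (length (ls ++ rs))      ≡⟨ cong suc (length-++ ls) ⟩
    suc (length ls + length rs)  ≡⟨ +-suc (length ls) (length rs) ⟨
    length ls + length (x ∷ rs)  ≡⟨ length-++ ls ⟨
    length (ls ++ x ∷ rs)        ∎
    where
    open ≤-Reasoning
    avoid : xs ⊆ ls ++ rs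
    avoid y∈ with ∈-++⁻ ls (xs⊆ys (there y∈))
    ... | inj₁ p             = ∈-++⁺ˡ p
    ... | inj₂ (here refl)   = ⊥-elim (All.lookup x≢ y∈ refl)
    ... | inj₂ (there p)     = ∈-++⁺ʳ ls p

  -- Averaging: if `g` were below `f` at every entry, the sums would compare strictly the other way.
  sum≤⇒∃≤ : ∀ (f g : A → ℕ) x xs → sum (map f (x ∷ xs)) ≤ sum (map g (x ∷ xs)) →
            ∃[ y ] y ∈ x ∷ xs × f y ≤ g y
  sum≤⇒∃≤ f g x [] le = x , here refl , +-cancelʳ-≤ 0 (f x) (g x) le
  sum≤⇒∃≤ f g x (y ∷ xs) le with f x ≤? g x
  ... | yes fx≤gx = x , here refl , fx≤gx
  ... | no  fx≰gx with sum≤⇒∃≤ f g y xs (≮⇒≥ λ lt → <⇒≱ (+-mono-< (≰⇒> fx≰gx) lt) le)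
  ...   | z , z∈ , fz≤gz = z , there z∈ , fz≤gz

  Unique-resp-↭ : ∀ {xs ys : List A} → xs ↭ ys → Unique xs → Unique ys
  Unique-resp-↭ xs↭ys = Permutation.Unique-resp-↭ (setoid A) (↭⇒↭ₛ xs↭ys)

  choose : ∀ {P Q : A → Set} {xs} → All (λ x → P x ⊎ Q x) xs → Any P xs ⊎ All Q xs
  choose []             = inj₂ []
  choose (inj₁ p ∷ _)   = inj₁ (here p)
  choose (inj₂ q ∷ pqs) with choose pqs
  ... | inj₁ ps = inj₁ (there ps)
  ... | inj₂ qs = inj₂ (q ∷ qs)

  propagate : ∀ {P : A → Set} {x xs} → Linked (λ a b → P a → P b) (x ∷ xs) → P x → All P (x ∷ xs)
  propagate [-]         px = px ∷ []
  propagate (f ∷ links) px = px ∷ propagate links (f px)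

  propagate⁻¹ : ∀ {P : A → Set} x xs y → Linked (λ a b → P a → P b) (x ∷ xs ++ [ y ]) →
    ¬ P y → All (λ a → ¬ P a) (x ∷ xs ++ [ y ])
  propagate⁻¹ x []       y (f ∷ _)     ¬py = (¬py ∘ f) ∷ ¬py ∷ []
  propagate⁻¹ x (z ∷ xs) y (f ∷ links) ¬py with propagate⁻¹ z xs y links ¬py
  ... | ¬pz ∷ ¬ps = (¬pz ∘ f) ∷ ¬pz ∷ ¬ps

  linked-∷ : ∀ {R : A → A → Set} {x xs} → All (R x) xs → Linked R xs → Linked R (x ∷ xs)
  linked-∷ []       _     = [-]
  linked-∷ (r ∷ _)  links = r ∷ links

  linked-++⁻ʳ : ∀ {R : A → A → Set} xs {ys} → Linked R (xs ++ ys) → Linked R ys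
  linked-++⁻ʳ []       links = links
  linked-++⁻ʳ (x ∷ xs) links = linked-++⁻ʳ xs (Linked.tail links)

  linked-∷ʳ : ∀ {R : A → A → Set} xs {y z} → Linked R (xs ++ [ y ]) → R y z → Linked R ((xs ++ [ y ]) ++ [ z ])
  linked-∷ʳ []           [-]         yz = yz ∷ [-]
  linked-∷ʳ (x ∷ [])     (xy ∷ [-])  yz = xy ∷ yz ∷ [-]
  linked-∷ʳ (x ∷ w ∷ xs) (xw ∷ rest) yz = xw ∷ linked-∷ʳ (w ∷ xs) rest yz

  Unique-++⁻ : ∀ (xs : List A) {ys} → Unique (xs ++ ys) → Unique xs × Unique ys × Disjoint xs ys
  Unique-++⁻ []       uniq = [] , uniq , λ { (() , _) }
  Unique-++⁻ (x ∷ xs) (x≢ ∷ uniq) with Unique-++⁻ xs uniq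
  ... | uxs , uys , disj = All.++⁻ˡ xs x≢ ∷ uxs , uys ,
    λ { (here refl , y∈) → All.lookup (All.++⁻ʳ xs x≢) y∈ refl ; (there x∈ , y∈) → disj (x∈ , y∈) }

  last-∷ʳ : ∀ (x : A) xs y → last (x ∷ xs ++ [ y ]) ≡ just y
  last-∷ʳ x []       y = refl
  last-∷ʳ x (z ∷ xs) y = last-∷ʳ z xs y

module _ {n : ℕ} where
  open DecMembership (_≟_ {n}) public using (_∈?_)

searchFin : ∀ {m} {P Q : Fin m → Set} → (∀ x → P x ⊎ Q x) → (∃[ x ] P x) ⊎ (∀ x → Q x)
searchFin {zero}  _ = inj₂ λ ()
searchFin {suc m} c with c zero | searchFin (c ∘ suc)
... | inj₁ p | _            = inj₁ (zero , p)
... | inj₂ _ | inj₁ (x , p) = inj₁ (suc x , p)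
... | inj₂ q | inj₂ qs      = inj₂ λ { zero → q ; (suc x) → qs x }

-- Degrees and domination in a tournament

module Degrees {n : ℕ} (T : Digraph n) (tour : Digraph.IsTournament T) where
  open Digraph T

  private
    variable
      x y : Fin n
      xs ys : List (Fin n)

  out in′ : List (Fin n) → Fin n → ℕ
  out xs x = length (filter (x ⟶?_) xs)
  in′ xs x = length (filter (_⟶? x) xs)

  asym : x ⟶ y → ¬ y ⟶ x
  asym {x} {y} xy yx with x ≟ y
  ... | yes refl = loopless x xy
  ... | no  x≢y with tour x y x≢y
  ...   | inj₁ (_ , ¬yx) = ¬yx yx
  ...   | inj₂ (_ , ¬xy) = ¬xy xy

  ¬⟶⇒⟵ : x ≢ y → ¬ x ⟶ y → y ⟶ x
  ¬⟶⇒⟵ {x} {y} x≢y ¬xy with tour x y x≢y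
  ... | inj₁ (xy , _) = ⊥-elim (¬xy xy)
  ... | inj₂ (yx , _) = yx

  ⟶⇒≢ : x ⟶ y → x ≢ y
  ⟶⇒≢ {x} xy refl = loopless x xy

  degree-∉ : ∀ {xs} → x ∉ xs → out xs x + in′ xs x ≡ length xs
  degree-∉ {xs = []} _ = refl
  degree-∉ {x} {y ∷ xs} x∉ with x ⟶? y | y ⟶? x
  ... | yes xy | yes yx = ⊥-elim (asym xy yx)
  ... | yes _  | no _   = cong suc (degree-∉ (x∉ ∘ there))
  ... | no _   | yes _  = trans (+-suc (out xs x) (in′ xs x)) (cong suc (degree-∉ (x∉ ∘ there)))
  ... | no ¬xy | no ¬yx = ⊥-elim (¬yx (¬⟶⇒⟵ (x∉ ∘ here) ¬xy))

  degree-∈ : ∀ {xs} → Unique xs → x ∈ xs → suc (out xs x + in′ xs x) ≡ length xs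
  degree-∈ {x} {x ∷ xs} uniq (here refl) with x ⟶? x
  ... | yes xx = ⊥-elim (loopless x xx)
  ... | no _   = cong suc (degree-∉ (Unique.Unique[x∷xs]⇒x∉xs uniq))
  degree-∈ {x} {y ∷ xs} (y≢ ∷ uniq) (there x∈) with x ⟶? y | y ⟶? x
  ... | yes xy | yes yx = ⊥-elim (asym xy yx)
  ... | yes _  | no _   = cong suc (degree-∈ uniq x∈)
  ... | no _   | yes _  = cong suc (trans (+-suc (out xs x) (in′ xs x)) (degree-∈ uniq x∈))
  ... | no ¬xy | no ¬yx = ⊥-elim (¬yx (¬⟶⇒⟵ (All.lookup y≢ x∈ ∘ sym) ¬xy))

  outdeg+indeg : ∀ x → suc (outdeg x + indeg x) ≡ n
  outdeg+indeg x = trans (degree-∈ (Unique.allFin⁺ n) (∈-allFin x)) (length-tabulate (λ i → i))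

  -- Double counting: both sides count the arcs from `xs` to `ys`.
  sum-out≡sum-in : ∀ xs ys → sum (map (out ys) xs) ≡ sum (map (in′ xs) ys)
  sum-out≡sum-in [] ys = zeros ys
    where
    zeros : ∀ ys → 0 ≡ sum (map (in′ []) ys)
    zeros []       = refl
    zeros (_ ∷ ys) = zeros ys
  sum-out≡sum-in (x ∷ xs) ys = trans (cong (out ys x +_) (sum-out≡sum-in xs ys)) (column ys)
    where
    swap : ∀ a b c → a + (b + c) ≡ b + (a + c)
    swap = solve-∀
    column : ∀ ys → out ys x + sum (map (in′ xs) ys) ≡ sum (map (in′ (x ∷ xs)) ys)
    column [] = refl
    column (y ∷ ys) with x ⟶? y
    ... | yes _ = cong suc (trans (swap (out ys x) (in′ xs y) _) (cong (in′ xs y +_) (column ys)))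
    ... | no _  = trans (swap (out ys x) (in′ xs y) _) (cong (in′ xs y +_) (column ys))

  ∃-in≤out : ∀ x xs → ∃[ y ] y ∈ x ∷ xs × in′ (x ∷ xs) y ≤ out (x ∷ xs) y
  ∃-in≤out x xs = sum≤⇒∃≤ _ _ x xs (≤-reflexive (sym (sum-out≡sum-in (x ∷ xs) (x ∷ xs))))

  opaque
    ∃-fresh-out : ∀ x zs → length zs < outdeg x → ∃[ y ] x ⟶ y × y ∉ zs
    ∃-fresh-out x zs lt with any? (λ y → (x ⟶? y) ×-dec ¬? (y ∈? zs))
    ... | yes found = found
    ... | no  none  = ⊥-elim (<⇒≱ lt (length-⊆ (Unique.filter⁺ (x ⟶?_) (Unique.allFin⁺ n)) sub))
      where
      sub : filter (x ⟶?_) (allFin n) ⊆ zs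
      sub {y} y∈ = decidable-stable (y ∈? zs)
        λ y∉ → none (y , proj₂ (∈-filter⁻ (x ⟶?_) {xs = allFin n} y∈) , y∉)

  -- Strong connectivity of the subtournament on `vs` in cut form: a decidable set that splits `vs`
  -- is left by an arc inside `vs`.
  Strong : List (Fin n) → Set₁
  Strong vs = ∀ {X : Fin n → Set} → Decidable X → ∀ {x y} → x ∈ vs → X x → y ∈ vs → ¬ X y →
    ∃[ a ] ∃[ b ] (a ∈ vs × X a) × (b ∈ vs × ¬ X b) × a ⟶ b

  module _ {k : ℕ} (out≤ : ∀ x → outdeg x ≤ indeg x + k) where

    2*outdeg≤ : ∀ x → suc (2 * outdeg x) ≤ n + k
    2*outdeg≤ x = begin
      suc (2 * outdeg x)              ≡⟨ cong suc (cong (outdeg x +_) (+-identityʳ _)) ⟩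
      suc (outdeg x + outdeg x)       ≤⟨ s≤s (+-monoʳ-≤ (outdeg x) (out≤ x)) ⟩
      suc (outdeg x + (indeg x + k))  ≡⟨ cong suc (+-assoc (outdeg x) (indeg x) k) ⟨
      suc (outdeg x + indeg x) + k    ≡⟨ cong (_+ k) (outdeg+indeg x) ⟩
      n + k                           ∎
      where open ≤-Reasoning

    n≤2*indeg : ∀ x → n ≤ suc (2 * indeg x) + k
    n≤2*indeg x = begin
      n                              ≡⟨ outdeg+indeg x ⟨
      suc (outdeg x + indeg x)       ≤⟨ s≤s (+-monoˡ-≤ (indeg x) (out≤ x)) ⟩
      suc (indeg x + k + indeg x)    ≡⟨ rearrange (indeg x) k ⟩
      suc (2 * indeg x) + k          ∎
      where
      open ≤-Reasoning
      rearrange : ∀ i k → suc (i + k + i) ≡ suc (2 * i) + k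
      rearrange = solve-∀

    -- By averaging, some `b` in `xs` has at least as many out- as in-neighbours inside `xs`. It
    -- also dominates all of `ys`, and the irregularity bounds its out-degree.
    dominating-bound : Unique xs → Unique ys → Disjoint xs ys → x ∈ xs →
      (∀ {a b} → a ∈ xs → b ∈ ys → a ⟶ b) → length xs + 2 * length ys ≤ n + k
    dominating-bound {xs@(x ∷ xs′)} {ys} uxs uys disj _ dom with ∃-in≤out x xs′
    ... | b , b∈ , in≤out = begin
      length xs + 2 * length ys                        ≡⟨ cong (_+ 2 * length ys) (degree-∈ uxs b∈) ⟨
      suc (out xs b + in′ xs b) + 2 * length ys        ≤⟨ s≤s (+-monoˡ-≤ (2 * length ys) (+-monoʳ-≤ (out xs b) in≤out)) ⟩
      suc (out xs b + out xs b) + 2 * length ys        ≡⟨ rearrange (out xs b) (length ys) ⟩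
      suc (2 * (out xs b + length ys))                 ≤⟨ s≤s (*-monoʳ-≤ 2 big) ⟩
      suc (2 * outdeg b)                               ≤⟨ 2*outdeg≤ b ⟩
      n + k                                            ∎
      where
      open ≤-Reasoning
      rearrange : ∀ o l → suc (o + o) + 2 * l ≡ suc (2 * (o + l))
      rearrange = solve-∀
      sub : filter (b ⟶?_) xs ++ ys ⊆ filter (b ⟶?_) (allFin n)
      sub y∈ with ∈-++⁻ (filter (b ⟶?_) xs) y∈
      ... | inj₁ p = ∈-filter⁺ (b ⟶?_) (∈-allFin _) (proj₂ (∈-filter⁻ (b ⟶?_) {xs = xs} p))
      ... | inj₂ p = ∈-filter⁺ (b ⟶?_) (∈-allFin _) (dom b∈ p)
      big : out xs b + length ys ≤ outdeg b
      big = subst (_≤ outdeg b) (length-++ (filter (b ⟶?_) xs))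
        (length-⊆ (Unique.++⁺ (Unique.filter⁺ (b ⟶?_) uxs) uys
          (λ (p , q) → disj (proj₁ (∈-filter⁻ (b ⟶?_) {xs = xs} p) , q))) sub)

-- Reversal exchanges out- and in-degrees, so that each bound for one serves the other.
op : ∀ {n} → Digraph n → Digraph n
op T = record { _⟶_ = flip _⟶_ ; _⟶?_ = flip _⟶?_ ; loopless = loopless }
  where open Digraph T

op-tournament : ∀ {n} (T : Digraph n) → Digraph.IsTournament T → Digraph.IsTournament (op T)
op-tournament T tour x y x≢y = tour y x (x≢y ∘ sym)

-- Consequences of bounded irregularity

module AlmostRegular {n k : ℕ} (T : Digraph n) (tour : Digraph.IsTournament T)
                     (irr : Digraph.irregularity T ≤ k) where
  open Digraph T
  open Degrees T tour public
  private module Op = Degrees (op T) (op-tournament T tour)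

  private
    variable
      as bs cs vs : List (Fin n)

    degree-gap : ∀ x → ∣ outdeg x - indeg x ∣ ≤ k
    degree-gap x = ≤-trans (All.lookup (xs≤max 0 _) (∈-map⁺ _ (∈-allFin x))) irr

  outdeg≤ : ∀ x → outdeg x ≤ indeg x + k
  outdeg≤ x = ≤-trans (m≤n+∣m-n∣ (outdeg x) (indeg x)) (+-monoʳ-≤ (indeg x) (degree-gap x))

  indeg≤ : ∀ x → indeg x ≤ outdeg x + k
  indeg≤ x = ≤-trans (m≤n+∣n-m∣ (indeg x) (outdeg x)) (+-monoʳ-≤ (outdeg x) (degree-gap x))

  n≤2*outdeg : ∀ x → n ≤ suc (2 * outdeg x) + k
  n≤2*outdeg = Op.n≤2*indeg indeg≤

  ∃-fresh-in : ∀ x zs → length zs < indeg x → ∃[ y ] y ⟶ x × y ∉ zs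
  ∃-fresh-in = Op.∃-fresh-out

  opaque
    -- Without such an arc, `bs` dominates `as ++ cs` and `as` is dominated by `bs ++ cs`. Adding
    -- the bound of `dominating-bound` for the former to its reversed form for the latter
    -- contradicts the size hypothesis.
    crossing : ∀ {a b} → Unique as → Unique bs → Unique cs →
      Disjoint as bs → Disjoint as cs → Disjoint bs cs → a ∈ as → b ∈ bs →
      (∀ {c a} → c ∈ cs → a ∈ as → c ⟶ a) → (∀ {b c} → b ∈ bs → c ∈ cs → b ⟶ c) →
      2 * (n + k) < 3 * (length as + length bs) + 4 * length cs →
      ∃[ a ] ∃[ b ] a ∈ as × b ∈ bs × a ⟶ b
    crossing {as} {bs} {cs} uas ubs ucs a#b a#c b#c a∈ b∈ c⟶a b⟶c large
      with Any.any? (λ a → Any.any? (a ⟶?_) bs) as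
    ... | yes found with find found
    ...   | a , a∈′ , found′ with find found′
    ...     | b , b∈′ , ab = a , b , a∈′ , b∈′ , ab
    crossing {as} {bs} {cs} uas ubs ucs a#b a#c b#c a∈ b∈ c⟶a b⟶c large
        | no none = ⊥-elim (<⇒≱ large (begin
      3 * (length as + length bs) + 4 * length cs  ≡⟨ rearrange (length as) (length bs) (length cs) ⟩
      (length bs + 2 * (length as + length cs)) + (length as + 2 * (length bs + length cs))
        ≡⟨ cong₂ (λ l m → (length bs + 2 * l) + (length as + 2 * m)) (length-++ as) (length-++ bs) ⟨
      (length bs + 2 * length (as ++ cs)) + (length as + 2 * length (bs ++ cs))
        ≤⟨ +-mono-≤ (dominating-bound outdeg≤ ubs (Unique.++⁺ uas ucs a#c) b#ac b∈ b⟶ac)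
                    (Op.dominating-bound indeg≤ uas (Unique.++⁺ ubs ucs b#c) a#bc a∈ a⟵bc) ⟩
      (n + k) + (n + k)                            ≡⟨ cong ((n + k) +_) (+-identityʳ (n + k)) ⟨
      2 * (n + k)                                  ∎))
      where
      open ≤-Reasoning
      rearrange : ∀ a b c → 3 * (a + b) + 4 * c ≡ (b + 2 * (a + c)) + (a + 2 * (b + c))
      rearrange = solve-∀
      b⟶a : ∀ {a b} → a ∈ as → b ∈ bs → b ⟶ a
      b⟶a a∈ b∈ = ¬⟶⇒⟵ (λ { refl → a#b (a∈ , b∈) }) (λ ab → none (lose a∈ (lose b∈ ab)))
      b#ac : Disjoint bs (as ++ cs)
      b#ac (p , q) with ∈-++⁻ as q
      ... | inj₁ r = a#b (r , p)
      ... | inj₂ r = b#c (p , r)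
      a#bc : Disjoint as (bs ++ cs)
      a#bc (p , q) with ∈-++⁻ bs q
      ... | inj₁ r = a#b (p , r)
      ... | inj₂ r = a#c (p , r)
      b⟶ac : ∀ {b x} → b ∈ bs → x ∈ as ++ cs → b ⟶ x
      b⟶ac p q with ∈-++⁻ as q
      ... | inj₁ r = b⟶a r p
      ... | inj₂ r = b⟶c p r
      a⟵bc : ∀ {a x} → a ∈ as → x ∈ bs ++ cs → x ⟶ a
      a⟵bc p q with ∈-++⁻ bs q
      ... | inj₁ r = b⟶a p r
      ... | inj₂ r = c⟶a r p

  opaque
    -- The case of `crossing` with `cs` empty, applied to the two sides of a cut.
    large⇒strong : Unique vs → 2 * (n + k) < 3 * length vs → Strong vs
    large⇒strong {vs} uvs large X? x∈ Xx y∈ ¬Xy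
      with crossing (Unique.filter⁺ X? uvs) (Unique.filter⁺ (¬? ∘ X?) uvs) []
        (λ (p , q) → proj₂ (∈-filter⁻ (¬? ∘ X?) {xs = vs} q) (proj₂ (∈-filter⁻ X? {xs = vs} p)))
        (λ { (_ , ()) }) (λ { (_ , ()) })
        (∈-filter⁺ X? x∈ Xx) (∈-filter⁺ (¬? ∘ X?) y∈ ¬Xy) (λ ()) (λ _ ())
        (begin-strict
          2 * (n + k)     <⟨ large ⟩
          3 * length vs   ≤⟨ *-monoʳ-≤ 3 (length-⊆ uvs split) ⟩
          3 * length (filter X? vs ++ filter (¬? ∘ X?) vs)
                          ≡⟨ cong (3 *_) (length-++ (filter X? vs)) ⟩
          3 * (length (filter X? vs) + length (filter (¬? ∘ X?) vs))
                          ≡⟨ +-identityʳ _ ⟨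
          3 * (length (filter X? vs) + length (filter (¬? ∘ X?) vs)) + 0 ∎)
      where
      open ≤-Reasoning
      split : vs ⊆ filter X? vs ++ filter (¬? ∘ X?) vs
      split {z} z∈ with X? z
      ... | yes Xz = ∈-++⁺ˡ (∈-filter⁺ X? z∈ Xz)
      ... | no ¬Xz = ∈-++⁺ʳ (filter X? vs) (∈-filter⁺ (¬? ∘ X?) z∈ ¬Xz)
    ... | a , b , a∈ , b∈ , ab =
      a , b , ∈-filter⁻ X? {xs = vs} a∈ , ∈-filter⁻ (¬? ∘ X?) {xs = vs} b∈ , ab

-- Inserting a vertex into a path

module Insertion {n : ℕ} (T : Digraph n) (tour : Digraph.IsTournament T) where
  open Digraph T
  open Degrees T tour

  step : ∀ a x b → x ≢ b → (a ⟶ x × x ⟶ b) ⊎ (a ⟶ x → b ⟶ x)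
  step a x b x≢b with a ⟶? x | x ⟶? b
  ... | yes ax | yes xb = inj₁ (ax , xb)
  ... | no ¬ax | _      = inj₂ (⊥-elim ∘ ¬ax)
  ... | yes _  | no ¬xb = inj₂ λ _ → ¬⟶⇒⟵ x≢b ¬xb

  -- The second alternative is the only obstruction: along the path, an arc into `x` is never
  -- followed by an arc out of `x`. The ends `s` and `e` stay in place.
  insert : ∀ x s l e → x ∉ s ∷ l ++ [ e ] → Linked _⟶_ (s ∷ l ++ [ e ]) →
    (∃[ l′ ] Linked _⟶_ (s ∷ l′ ++ [ e ]) × l′ ↭ x ∷ l)
    ⊎ Linked (λ a b → a ⟶ x → b ⟶ x) (s ∷ l ++ [ e ])
  insert x s [] e x∉ _ with step s x e (x∉ ∘ there ∘ here)
  ... | inj₁ (sx , xe) = inj₁ ([ x ] , sx ∷ xe ∷ [-] , ↭-refl)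
  ... | inj₂ f         = inj₂ (f ∷ [-])
  insert x s (y ∷ l) e x∉ (sy ∷ links)
    with step s x y (x∉ ∘ there ∘ here) | insert x y l e (x∉ ∘ there) links
  ... | inj₁ (sx , xy) | _ = inj₁ (x ∷ y ∷ l , sx ∷ xy ∷ links , ↭-refl)
  ... | inj₂ f | inj₂ fs = inj₂ (f ∷ fs)
  ... | inj₂ _ | inj₁ (l′ , links′ , l′↭) =
    inj₁ (y ∷ l′ , sy ∷ links′ , ↭-trans (↭-prep y l′↭) (↭-swap y x ↭-refl))

-- Families of routes and absorption of the remaining vertices

-- A route between p and q is stored as its direction and its list of inner
-- vertices. The case p ≡ q is allowed: a route is then a cycle through p.
module Routes {n : ℕ} (T : Digraph n) (tour : Digraph.IsTournament T)
              (vs : List (Fin n)) (p q : Fin n) where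
  open Digraph T
  open Degrees T tour
  open Insertion T tour

  Route : Set
  Route = Bool × List (Fin n)

  src tgt : Bool → Fin n
  src true  = p
  src false = q
  tgt d = src (not d)

  vertices : Route → List (Fin n)
  vertices (d , l) = src d ∷ l ++ [ tgt d ]

  Valid : Route → Set
  Valid r = Linked _⟶_ (vertices r)

  inner : List Route → List (Fin n)
  inner F = concat (map proj₂ F)

  core : List Route → List (Fin n)
  core F = p ∷ q ∷ inner F

  -- Uniqueness of the concatenated inner vertices says at once that no route repeats one and that
  -- the routes are internally disjoint.
  record Good (F : List Route) : Set where
    field
      valid  : All Valid F
      unique : Unique (inner F)
      fits   : All (λ x → x ∈ vs × x ≢ p × x ≢ q) (inner F)

  -- Routes keep their directions, which preserves `Attached`, and do not get shorter, which keeps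
  -- nonempty routes nonempty.
  _≼_ : List Route → List Route → Set
  _≼_ = Pointwise λ r r′ → proj₁ r ≡ proj₁ r′ × length (proj₂ r) ≤ length (proj₂ r′)

  ≼-refl : ∀ {F} → F ≼ F
  ≼-refl = Pointwise.refl (refl , ≤-refl)

  ≼-trans : ∀ {F G H} → F ≼ G → G ≼ H → F ≼ H
  ≼-trans = Pointwise.transitive λ { (refl , l≤) (refl , m≤) → refl , ≤-trans l≤ m≤ }

  -- Excludes the vertices x with x ⟶ s and e ⟶ x for every route from s to e:
  -- those neither fit into a route nor are comparable with all of it.
  Attached : List Route → Set
  Attached F = ∀ {x} → x ∈ vs → x ≢ p → x ≢ q →
    Any (λ r → src (proj₁ r) ⟶ x ⊎ x ⟶ tgt (proj₁ r)) F

  attached-≼ : ∀ {F G} → F ≼ G → Attached F → Attached G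
  attached-≼ F≼G att x∈ x≢p x≢q =
    Pointwise.Any-resp-Pointwise (λ { (refl , _) a → a }) F≼G (att x∈ x≢p x≢q)

  Longer : List (Fin n) → Route → Set
  Longer xs (d , l) = ∃[ l′ ] Valid (d , l′) × l′ ↭ xs ++ l

  lengthen : ∀ xs {F} → All Valid F → Any (Longer xs) F →
    ∃[ G ] All Valid G × inner G ↭ xs ++ inner F × F ≼ G
  lengthen xs {(d , l) ∷ F} (_ ∷ vF) (here (l′ , v′ , l′↭)) =
    (d , l′) ∷ F , v′ ∷ vF ,
    subst (l′ ++ inner F ↭_) (++-assoc xs l (inner F)) (++⁺ʳ (inner F) l′↭) ,
    (refl , l≤l′) ∷ ≼-refl
    where
    l≤l′ : length l ≤ length l′
    l≤l′ = subst (length l ≤_) (sym (trans (↭-length l′↭) (length-++ xs))) (m≤n+m (length l) (length xs))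
  lengthen xs {(d , l) ∷ F} (v ∷ vF) (there longer) with lengthen xs vF longer
  ... | G , vG , G↭ , F≼G =
    (d , l) ∷ G , v ∷ vG , ↭-trans (++⁺ˡ l G↭) (shifts l xs) , (refl , ≤-refl) ∷ F≼G

  Spans : List Route → Set
  Spans F = ∀ {x} → x ∈ vs → x ∈ core F

  module Saturation (p∈ : p ∈ vs) (strong : Strong vs) where

    module _ {F : List Route} (good : Good F) (att : Attached F) where
      open Good good

      Extension : Set
      Extension = ∃[ G ] Good G × F ≼ G × length (inner F) < length (inner G)

      ∉core⇒fits : ∀ {x} → x ∈ vs → x ∉ core F → x ∈ vs × x ≢ p × x ≢ q
      ∉core⇒fits x∈ x∉ = x∈ , x∉ ∘ here , x∉ ∘ there ∘ here

      extend : ∀ x xs → Unique (x ∷ xs) → All (λ y → y ∈ vs × y ∉ core F) (x ∷ xs) →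
               Any (Longer (x ∷ xs)) F → Extension
      extend x xs uxs new longer with lengthen (x ∷ xs) valid longer
      ... | G , vG , G↭ , F≼G = G , goodG , F≼G ,
        subst (length (inner F) <_) (sym (trans (↭-length G↭) (cong suc (length-++ xs))))
          (s≤s (m≤n+m (length (inner F)) (length xs)))
        where
        goodG : Good G
        goodG = record
          { valid  = vG
          ; unique = Unique-resp-↭ (↭-sym G↭) (Unique.++⁺ uxs unique
              λ (y∈ , y∈F) → proj₂ (All.lookup new y∈) (there (there y∈F)))
          ; fits   = All-resp-↭ (↭-sym G↭) (All.++⁺ (All.map (λ (y∈ , y∉) → ∉core⇒fits y∈ y∉) new) fits)
          }

      src≢ : ∀ d {x} → x ∉ core F → x ≢ src d
      src≢ true  x∉ = x∉ ∘ here
      src≢ false x∉ = x∉ ∘ there ∘ here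

      ∉vertices : ∀ {x r} → x ∉ core F → r ∈ F → x ∉ vertices r
      ∉vertices {r = d , l} x∉ r∈ (here eq) = src≢ d x∉ eq
      ∉vertices {r = d , l} x∉ r∈ (there x∈) with ∈-++⁻ l x∈
      ... | inj₁ x∈l        = x∉ (there (there (∈-concat⁺′ x∈l (∈-map⁺ proj₂ r∈))))
      ... | inj₂ (here eq)  = src≢ (not d) x∉ eq

      -- The ends of any single route are `p` and `q` in some order, so a property of its two ends
      -- holds at the ends of all routes; `along` then carries it inside.
      spread : ∀ {P : Fin n → Set} d → P (src d) → P (tgt d) →
        (∀ {r} → r ∈ F → P (src (proj₁ r)) → P (tgt (proj₁ r)) → All P (proj₂ r)) → All P (core F)
      spread {P} d ps pt along = everywhere true ∷ everywhere false ∷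
        All.concat⁺ (All.map⁺ (All.tabulate λ r∈ → along r∈ (everywhere _) (everywhere _)))
        where
        everywhere′ : ∀ d d′ → P (src d) → P (tgt d) → P (src d′)
        everywhere′ true  true  ps pt = ps
        everywhere′ true  false ps pt = pt
        everywhere′ false true  ps pt = pt
        everywhere′ false false ps pt = ps
        everywhere : ∀ d′ → P (src d′)
        everywhere d′ = everywhere′ d d′ ps pt

      -- If `x` fits nowhere, an attached route settles its side: an arc from the source to `x`
      -- propagates forwards along the route, an arc from `x` to the target propagates backwards.
      -- Either way both ends agree, and `spread` applies.
      classify : ∀ {x} → x ∈ vs → x ∉ core F →
        Extension ⊎ (All (_⟶ x) (core F) ⊎ All (x ⟶_) (core F))
      classify {x} x∈ x∉
        with choose (All.tabulate {xs = F} λ {r} r∈ →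
               insert x _ (proj₂ r) _ (∉vertices x∉ r∈) (All.lookup valid r∈))
      ... | inj₁ longer = inj₁ (extend x [] ([] ∷ []) ((x∈ , x∉) ∷ []) longer)
      ... | inj₂ closed with find (att x∈ (x∉ ∘ here) (x∉ ∘ there ∘ here))
      ...   | (d , l) , r∈ , inj₁ sx = inj₂ (inj₁ (spread d sx
                (All.lookup (propagate (All.lookup closed r∈) sx) (there (∈-++⁺ʳ l (here refl))))
                λ {r} r∈ s⟶x _ → All.++⁻ˡ (proj₂ r) (All.tail (propagate (All.lookup closed r∈) s⟶x))))
      ...   | (d , l) , r∈ , inj₂ xt = inj₂ (inj₂ (All.tabulate λ {y} y∈ →
                ¬⟶⇒⟵ (λ { refl → x∉ y∈ }) (All.lookup none y∈)))
        where
        none : All (λ y → ¬ y ⟶ x) (core F)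
        none = spread d
          (All.head (propagate⁻¹ _ l _ (All.lookup closed r∈) (asym xt))) (asym xt)
          λ {r} r∈ _ ¬t⟶x → All.++⁻ˡ (proj₂ r) (All.tail (propagate⁻¹ _ (proj₂ r) _ (All.lookup closed r∈) ¬t⟶x))

      -- Neither vertex fits alone, but `a` and `b` together go right after the source of any route,
      -- since `b` dominates whatever comes next.
      extend-pair : ∀ {a b} → a ∈ vs → a ∉ core F → b ∈ vs → b ∉ core F →
        All (_⟶ a) (core F) → All (b ⟶_) (core F) → a ⟶ b → Extension
      extend-pair {a} {b} a∈ a∉ b∈ b∉ below above ab
        with find (att a∈ (a∉ ∘ here) (a∉ ∘ there ∘ here))
      ... | (d , l) , r∈ , _ = extend a [ b ] ((⟶⇒≢ ab ∷ []) ∷ [] ∷ []) ((a∈ , a∉) ∷ (b∈ , b∉) ∷ [])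
        (lose r∈ (a ∷ b ∷ l ,
          All.lookup below (src∈ d) ∷ ab ∷ linked-∷ above′ (Linked.tail (All.lookup valid r∈)) , ↭-refl))
        where
        src∈ : ∀ d → src d ∈ core F
        src∈ true  = here refl
        src∈ false = there (here refl)
        above′ : All (b ⟶_) (l ++ [ tgt d ])
        above′ = All.++⁺
          (All.tabulate λ y∈ → All.lookup above (there (there (∈-concat⁺′ y∈ (∈-map⁺ proj₂ r∈)))))
          (All.lookup above (src∈ (not d)) ∷ [])

      -- Once every uncovered vertex dominates the core or is dominated by it, strong connectivity
      -- yields an arc from one of the latter to one of the former, as `extend-pair` requires.
      improve : Extension ⊎ Spans F
      improve with searchFin {P = λ _ → Extension}
                     {Q = λ x → x ∈ vs → x ∉ core F → All (_⟶ x) (core F) ⊎ All (x ⟶_) (core F)} status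
        where
        status : ∀ x → Extension ⊎ (x ∈ vs → x ∉ core F → All (_⟶ x) (core F) ⊎ All (x ⟶_) (core F))
        status x with x ∈? vs | x ∈? core F
        ... | no x∉  | _      = inj₂ λ x∈ → ⊥-elim (x∉ x∈)
        ... | yes _  | yes x∈ = inj₂ λ _ x∉ → ⊥-elim (x∉ x∈)
        ... | yes x∈ | no x∉ with classify x∈ x∉
        ...   | inj₁ ext = inj₁ ext
        ...   | inj₂ c   = inj₂ λ _ _ → c
      ... | inj₁ (_ , ext) = inj₁ ext
      ... | inj₂ sides with any? (λ x → (x ∈? vs) ×-dec ¬? (x ∈? core F))
      ...   | no none = inj₂ λ {x} x∈ → decidable-stable (x ∈? core F) λ x∉ → none (x , x∈ , x∉)
      ...   | yes (x , x∈ , x∉) with sides x x∈ x∉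
      ...     | inj₁ (px ∷ _)
        -- The cut set consists of the uncovered vertices dominated by `p`. The arc leaving it
        -- cannot end in the core, which dominates `a`; so `b` is uncovered and dominates the core.
        with strong (λ y → ¬? (y ∈? core F) ×-dec (p ⟶? y)) x∈ (x∉ , px) p∈ (λ (p∉ , _) → p∉ (here refl))
      ...       | a , b , (a∈ , a∉ , pa) , (b∈ , ¬Xb) , ab with sides a a∈ a∉ | b ∈? core F
      ...         | inj₂ (ap ∷ _) | _ = ⊥-elim (asym pa ap)
      ...         | inj₁ below | yes b∈F = ⊥-elim (asym ab (All.lookup below b∈F))
      ...         | inj₁ below | no b∉ with sides b b∈ b∉
      ...           | inj₁ (pb ∷ _) = ⊥-elim (¬Xb (b∉ , pb))
      ...           | inj₂ above    = inj₁ (extend-pair a∈ a∉ b∈ b∉ below above ab)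
      improve | inj₂ sides | yes (x , x∈ , x∉) | inj₂ (xp ∷ _)
        -- The dual cut: the core together with all vertices that do not dominate `p`. The arc
        -- leaving it cannot start in the core, which `b` dominates; so `a` is uncovered and
        -- dominated by the core.
        with strong (λ y → (y ∈? core F) ⊎-dec ¬? (y ⟶? p)) p∈ (inj₁ (here refl)) x∈
               (λ { (inj₁ x∈F) → x∉ x∈F ; (inj₂ ¬xp) → ¬xp xp })
      ... | a , b , (a∈ , Xa) , (b∈ , ¬Xb) , ab with sides b b∈ (¬Xb ∘ inj₁) | a ∈? core F
      ...   | inj₁ (pb ∷ _) | _      = ⊥-elim (¬Xb (inj₂ (asym pb)))
      ...   | inj₂ above | yes a∈F = ⊥-elim (asym ab (All.lookup above a∈F))
      ...   | inj₂ above | no a∉ with sides a a∈ a∉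
      ...     | inj₁ below = inj₁ (extend-pair a∈ a∉ b∈ (¬Xb ∘ inj₁) below above ab)
      ...     | inj₂ (ap ∷ _) with Xa
      ...       | inj₁ a∈F = ⊥-elim (a∉ a∈F)
      ...       | inj₂ ¬ap = ⊥-elim (¬ap ap)

    -- Inner vertices are distinct members of `vs` and every extension adds at least one, so `fuel`
    -- bounds the number of extensions still possible.
    saturate′ : ∀ fuel {F} → Good F → Attached F → length vs ≤ fuel + length (inner F) →
      ∃[ G ] Good G × F ≼ G × Spans G
    saturate′ fuel {F} good att enough with improve good att
    ... | inj₂ spans = F , good , ≼-refl , spans
    saturate′ zero good att enough | inj₁ (G , goodG , F≼G , lt) =
      ⊥-elim (<⇒≱ lt (≤-trans (length-⊆ (Good.unique goodG) (proj₁ ∘ All.lookup (Good.fits goodG))) enough))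
    saturate′ (suc fuel) {F} good att enough | inj₁ (G , goodG , F≼G , lt)
      with saturate′ fuel goodG (attached-≼ F≼G att)
             (≤-trans enough (≤-trans (≤-reflexive (sym (+-suc fuel (length (inner F))))) (+-monoʳ-≤ fuel lt)))
    ... | H , goodH , G≼H , spans = H , goodH , ≼-trans F≼G G≼H , spans

    opaque
      saturate : ∀ {F} → Good F → Attached F → ∃[ G ] Good G × F ≼ G × Spans G
      saturate good att = saturate′ (length vs) good att (m≤m+n _ _)

-- From spanning families of routes to weak containers

module Containers {n : ℕ} (T : Digraph n) (tour : Digraph.IsTournament T)
                  {u v : Fin n} (u≢v : u ≢ v) where
  open Digraph T
  open Degrees T tour
  open Routes T tour (allFin n) u v public

  Nonempty : Route → Set
  Nonempty r = 0 < length (proj₂ r)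

  inner-∈ : ∀ {F : List Route} i {x} → x ∈ proj₂ (lookup F i) → x ∈ inner F
  inner-∈ {F} i x∈ = ∈-concat⁺′ x∈ (∈-map⁺ proj₂ (∈-lookup {xs = F} i))

  lookup-unique : ∀ F → Unique (inner F) → ∀ i → Unique (proj₂ (lookup F i))
  lookup-unique ((_ , l) ∷ F) uniq zero    = proj₁ (Unique-++⁻ l uniq)
  lookup-unique ((_ , l) ∷ F) uniq (suc i) = lookup-unique F (proj₁ (proj₂ (Unique-++⁻ l uniq))) i

  lookup-disjoint : ∀ F → Unique (inner F) → ∀ i j → i ≢ j →
    Disjoint (proj₂ (lookup F i)) (proj₂ (lookup F j))
  lookup-disjoint (_ ∷ _) uniq zero zero i≢j = ⊥-elim (i≢j refl)
  lookup-disjoint ((_ , l) ∷ F) uniq zero (suc j) _ (x∈i , x∈j) =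
    proj₂ (proj₂ (Unique-++⁻ l uniq)) (x∈i , inner-∈ {F} j x∈j)
  lookup-disjoint ((_ , l) ∷ F) uniq (suc i) zero _ (x∈i , x∈j) =
    proj₂ (proj₂ (Unique-++⁻ l uniq)) (x∈j , inner-∈ {F} i x∈i)
  lookup-disjoint ((_ , l) ∷ F) uniq (suc i) (suc j) i≢j =
    lookup-disjoint F (proj₁ (proj₂ (Unique-++⁻ l uniq))) i j (i≢j ∘ cong suc)

  unique-vertices : ∀ d l → Unique l → All (λ x → x ≢ u × x ≢ v) l → Unique (vertices (d , l))
  unique-vertices d l ul avoid =
    All.++⁺ (All.map (λ ne eq → proj₁ (ends d ne) (sym eq)) avoid) (src≢tgt d ∷ []) ∷
    Unique.++⁺ ul ([] ∷ []) λ { (x∈ , here refl) → proj₂ (ends d (All.lookup avoid x∈)) refl }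
    where
    ends : ∀ d {x} → x ≢ u × x ≢ v → x ≢ src d × x ≢ tgt d
    ends true  (x≢u , x≢v) = x≢u , x≢v
    ends false (x≢u , x≢v) = x≢v , x≢u
    src≢tgt : ∀ d → src d ≢ tgt d
    src≢tgt true  = u≢v
    src≢tgt false = u≢v ∘ sym

  isPath-vertices : ∀ r → Valid r → Unique (proj₂ r) → All (λ x → x ≢ u × x ≢ v) (proj₂ r) →
    IsPath u v (vertices r) ⊎ IsPath v u (vertices r)
  isPath-vertices (true , l) val ul avoid = inj₁ record
    { starts = refl ; ends = last-∷ʳ u l v ; arcs = val ; simple = unique-vertices true l ul avoid }
  isPath-vertices (false , l) val ul avoid = inj₂ record
    { starts = refl ; ends = last-∷ʳ v l u ; arcs = val ; simple = unique-vertices false l ul avoid }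

  ∈-vertices⁻ : ∀ r {x} → x ∈ vertices r → (x ≡ u ⊎ x ≡ v) ⊎ x ∈ proj₂ r
  ∈-vertices⁻ (d , l) (here refl) = inj₁ (end d)
    where
    end : ∀ d → src d ≡ u ⊎ src d ≡ v
    end true  = inj₁ refl
    end false = inj₂ refl
  ∈-vertices⁻ (d , l) (there x∈) with ∈-++⁻ l x∈
  ... | inj₁ x∈l         = inj₂ x∈l
  ... | inj₂ (here refl) = ∈-vertices⁻ (not d , l) (here refl)

  -- Only the head `r` may be a bare arc. Any other route has an inner vertex, and an equal path
  -- elsewhere in the family would share it, against disjointness.
  container : ∀ {r F} → Good (r ∷ F) → Spans (r ∷ F) → All Nonempty F →
    WeakContainer (suc (length F)) u v
  container {r} {F} good spans nonempty = record
    { path     = path′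
    ; isPath   = λ i → isPath-vertices (lookup (r ∷ F) i) (All.lookup valid (∈-lookup {xs = r ∷ F} i))
        (lookup-unique (r ∷ F) unique i) (All.tabulate λ x∈ → avoids i x∈)
    ; distinct = λ {i} {j} → distinct′ i j
    ; disjoint = disjoint′
    ; spanning = spanning′
    }
    where
    open Good good
    path′ : Fin (suc (length F)) → List (Fin n)
    path′ i = vertices (lookup (r ∷ F) i)
    avoids : ∀ i {x} → x ∈ proj₂ (lookup (r ∷ F) i) → x ≢ u × x ≢ v
    avoids i x∈ = proj₂ (All.lookup fits (inner-∈ {r ∷ F} i x∈))
    disjoint′ : ∀ i j → i ≢ j → ∀ x → x ∈ path′ i → x ∈ path′ j → x ≡ u ⊎ x ≡ v
    disjoint′ i j i≢j x x∈i x∈j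
      with ∈-vertices⁻ (lookup (r ∷ F) i) x∈i | ∈-vertices⁻ (lookup (r ∷ F) j) x∈j
    ... | inj₁ end | _        = end
    ... | inj₂ _   | inj₁ end = end
    ... | inj₂ p   | inj₂ q   = ⊥-elim (lookup-disjoint (r ∷ F) unique i j i≢j (p , q))
    shared : ∀ i j → suc i ≢ j → path′ (suc i) ≢ path′ j
    shared i j i≢j eq with lookup F i in eq′ | All.lookup nonempty (∈-lookup {xs = F} i)
    ... | d , y ∷ l | _ with avoids (suc i) {y} (subst (λ r → y ∈ proj₂ r) (sym eq′) (here refl))
    ...   | y≢u , y≢v with disjoint′ (suc i) j i≢j y
                             (subst (λ r → y ∈ vertices r) (sym eq′) (there (here refl)))
                             (subst (y ∈_) eq (there (here refl)))
    ...     | inj₁ y≡u = y≢u y≡u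
    ...     | inj₂ y≡v = y≢v y≡v
    distinct′ : ∀ i j → path′ i ≡ path′ j → i ≡ j
    distinct′ i j eq with i ≟ j
    ... | yes i≡j = i≡j
    distinct′ (suc i) j       eq | no i≢j = ⊥-elim (shared i j i≢j eq)
    distinct′ zero    (suc j) eq | no i≢j = ⊥-elim (shared j zero (i≢j ∘ sym) (sym eq))
    distinct′ zero    zero    eq | no i≢j = refl
    end∈ : ∀ r′ → u ∈ vertices r′ × v ∈ vertices r′
    end∈ (true  , l) = here refl , there (∈-++⁺ʳ l (here refl))
    end∈ (false , l) = there (∈-++⁺ʳ l (here refl)) , here refl
    spanning′ : ∀ x → ∃[ i ] x ∈ path′ i
    spanning′ x with spans (∈-allFin x)
    ... | here refl         = zero , proj₁ (end∈ r)
    ... | there (here refl) = zero , proj₂ (end∈ r)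
    ... | there (there x∈) with ∈-concat⁻′ (map proj₂ (r ∷ F)) x∈
    ...   | l , x∈l , l∈ with ∈-map⁻ proj₂ l∈
    ...     | r′ , r′∈ , refl = Any.index r′∈ ,
      subst (λ r″ → x ∈ vertices r″) (lookup-index r′∈) (there (∈-++⁺ˡ x∈l))

-- Numerical consequences of the bound on n

module Connectivity {n k t : ℕ} (T : Digraph n) (tour : Digraph.IsTournament T)
  (irr : Digraph.irregularity T ≤ k) (2≤t : 2 ≤ t) (large : 6 * t + 5 * k ≤ n + 3)
  {u v : Fin n} (u≢v : u ≢ v) where
  open Digraph T
  open AlmostRegular T tour irr

  private
    -- Dropping 4k from the hypothesis on n leaves 3t ≤ d + 2, and 2 ≤ t finishes.
    2t≤ : ∀ d → n ≤ suc (2 * d) + k → 2 * t ≤ d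
    2t≤ d n≤ = +-cancelʳ-≤ t (2 * t) d (begin
      2 * t + t  ≡⟨ +-comm (2 * t) t ⟩
      3 * t      ≤⟨ *-cancelˡ-≤ 2 (+-cancelʳ-≤ k (2 * (3 * t)) (2 * (d + 2)) doubled) ⟩
      d + 2      ≤⟨ +-monoʳ-≤ d 2≤t ⟩
      d + t      ∎)
      where
      open ≤-Reasoning
      expand : ∀ t k → 2 * (3 * t) + k + 4 * k ≡ 6 * t + 5 * k
      expand = solve-∀
      collect : ∀ d k → suc (2 * d) + k + 3 ≡ 2 * (d + 2) + k
      collect = solve-∀
      doubled : 2 * (3 * t) + k ≤ 2 * (d + 2) + k
      doubled = begin
        2 * (3 * t) + k          ≤⟨ m≤m+n _ (4 * k) ⟩
        2 * (3 * t) + k + 4 * k  ≡⟨ expand t k ⟩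
        6 * t + 5 * k            ≤⟨ large ⟩
        n + 3                    ≤⟨ +-monoˡ-≤ 3 n≤ ⟩
        suc (2 * d) + k + 3      ≡⟨ collect d k ⟩
        2 * (d + 2) + k          ∎

  opaque
    2t≤outdeg : ∀ x → 2 * t ≤ outdeg x
    2t≤outdeg x = 2t≤ (outdeg x) (n≤2*outdeg x)

    2t≤indeg : ∀ x → 2 * t ≤ indeg x
    2t≤indeg x = 2t≤ (indeg x) (n≤2*indeg outdeg≤ x)

    4≤2t : 4 ≤ 2 * t
    4≤2t = *-monoʳ-≤ 2 2≤t

    5k+9≤n : 5 * k + 9 ≤ n
    5k+9≤n = +-cancelʳ-≤ 3 (5 * k + 9) n (begin
      5 * k + 9 + 3  ≡⟨ +-assoc (5 * k) 9 3 ⟩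
      5 * k + 12     ≡⟨ +-comm (5 * k) 12 ⟩
      12 + 5 * k     ≤⟨ +-monoˡ-≤ (5 * k) (*-monoʳ-≤ 6 2≤t) ⟩
      6 * t + 5 * k  ≤⟨ large ⟩
      n + 3          ∎)
      where open ≤-Reasoning

    -- Leaving out at most two vertices preserves strong connectivity: 2(n + k) < 3(n - 2) as soon
    -- as n > 2k + 6.
    strong-upto-2 : ∀ {vs} → Unique vs → n ≤ 2 + length vs → Strong vs
    strong-upto-2 {vs} uvs n≤ = large⇒strong uvs (+-cancelʳ-< 6 _ _ (begin-strict
      2 * (n + k) + 6        <⟨ m<m+n _ {suc (2 + 3 * k)} (s≤s z≤n) ⟩
      2 * (n + k) + 6 + suc (2 + 3 * k) ≡⟨ collect n k ⟩
      2 * n + (5 * k + 9)    ≤⟨ +-monoʳ-≤ (2 * n) 5k+9≤n ⟩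
      2 * n + n              ≡⟨ triple n ⟩
      3 * n                  ≤⟨ *-monoʳ-≤ 3 n≤ ⟩
      3 * (2 + length vs)    ≡⟨ expand (length vs) ⟩
      3 * length vs + 6      ∎))
      where
      open ≤-Reasoning
      collect : ∀ n k → 2 * (n + k) + 6 + suc (2 + 3 * k) ≡ 2 * n + (5 * k + 9)
      collect = solve-∀
      triple : ∀ n → 2 * n + n ≡ 3 * n
      triple = solve-∀
      expand : ∀ l → 3 * (2 + l) ≡ 3 * l + 6
      expand = solve-∀

  -- Containers with at least two paths

  module Several where
    open Containers T tour u≢v

    cons : ∀ {d l G} → Good G → Valid (d , l) → Unique l → All (λ x → x ∉ core G) l → Good ((d , l) ∷ G)
    cons good val ul new = record
      { valid  = val ∷ valid
      ; unique = Unique.++⁺ ul unique λ (x∈l , x∈G) → All.lookup new x∈l (there (there x∈G))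
      ; fits   = All.++⁺ (All.map (λ x∉ → ∈-allFin _ , x∉ ∘ here , x∉ ∘ there ∘ here) new) fits
      }
      where open Good good

    Small : Route → Set
    Small r = Nonempty r × length (proj₂ r) ≤ 2

    module _ {G} (good : Good G) (small : length (inner G) ≤ 2 * length G) (G<t : length G < t) where

      private
        Free : Fin n → Set
        Free x = x ∉ core G

        free? : Decidable Free
        free? x = ¬? (x ∈? core G)

        as? : Decidable (λ x → Free x × u ⟶ x × v ⟶ x)
        as? x = free? x ×-dec (u ⟶? x) ×-dec (v ⟶? x)

        bs? : Decidable (λ x → Free x × x ⟶ u × x ⟶ v)
        bs? x = free? x ×-dec (x ⟶? u) ×-dec (x ⟶? v)

        as bs : List (Fin n)
        as = filter as? (allFin n)
        bs = filter bs? (allFin n)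

        ∈as : ∀ {x} → x ∈ as → Free x × u ⟶ x × v ⟶ x
        ∈as x∈ = proj₂ (∈-filter⁻ as? {xs = allFin n} x∈)

        ∈bs : ∀ {x} → x ∈ bs → Free x × x ⟶ u × x ⟶ v
        ∈bs x∈ = proj₂ (∈-filter⁻ bs? {xs = allFin n} x∈)

        opaque
          -- The extra one accounts for `v`, which is avoided along with the inner vertices when a
          -- free neighbour of `u` is sought.
          inner<2t : suc (length (inner G)) < 2 * t
          inner<2t = begin-strict
            suc (length (inner G))  ≤⟨ s≤s small ⟩
            suc (2 * length G)      <⟨ n<1+n _ ⟩
            2 + 2 * length G        ≡⟨ *-suc 2 (length G) ⟨
            2 * suc (length G)      ≤⟨ *-monoʳ-≤ 2 G<t ⟩
            2 * t                   ∎
            where open ≤-Reasoning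

        -- This is the size hypothesis of `crossing`; the 8 is four times the length of
        -- `u ∷ v ∷ []`, which plays the role of `cs`.
        enough : n ≤ 2 + length (inner G) + (length as + length bs) →
                 2 * (n + k) < 3 * (length as + length bs) + 8
        enough n≤ = +-cancelʳ-< (n + 6 * t) _ _ (begin-strict
          2 * (n + k) + (n + 6 * t)           ≤⟨ m≤m+n _ (3 * k) ⟩
          2 * (n + k) + (n + 6 * t) + 3 * k   ≡⟨ collect n k t ⟩
          3 * n + (6 * t + 5 * k)             ≤⟨ +-mono-≤ (*-monoʳ-≤ 3 n≤) large ⟩
          3 * (2 + c + s) + (n + 3)           ≡⟨ expand c s n ⟩
          3 * suc (suc c) + (3 * s + 3 + n)   ≤⟨ +-monoˡ-≤ (3 * s + 3 + n) (*-monoʳ-≤ 3 inner<2t) ⟩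
          3 * (2 * t) + (3 * s + 3 + n)       <⟨ m<m+n _ {5} (s≤s z≤n) ⟩
          3 * (2 * t) + (3 * s + 3 + n) + 5   ≡⟨ regroup t s n ⟩
          3 * s + 8 + (n + 6 * t)             ∎)
          where
          open ≤-Reasoning
          c = length (inner G)
          s = length as + length bs
          collect : ∀ n k t → 2 * (n + k) + (n + 6 * t) + 3 * k ≡ 3 * n + (6 * t + 5 * k)
          collect = solve-∀
          expand : ∀ c s n → 3 * (2 + c + s) + (n + 3) ≡ 3 * suc (suc c) + (3 * s + 3 + n)
          expand = solve-∀
          regroup : ∀ t s n → 3 * (2 * t) + (3 * s + 3 + n) + 5 ≡ 3 * s + 8 + (n + 6 * t)
          regroup = solve-∀

      private
        module _ (no-uv : ¬ (∃[ x ] Free x × u ⟶ x × x ⟶ v)) (no-vu : ¬ (∃[ x ] Free x × v ⟶ x × x ⟶ u)) where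

          ⟵u⇒∈as : ∀ {x} → Free x → u ⟶ x → x ∈ as
          ⟵u⇒∈as {x} x∉ ux = ∈-filter⁺ as? (∈-allFin x)
            (x∉ , ux , ¬⟶⇒⟵ (x∉ ∘ there ∘ here) (λ xv → no-uv (x , x∉ , ux , xv)))

          ⟶u⇒∈bs : ∀ {x} → Free x → x ⟶ u → x ∈ bs
          ⟶u⇒∈bs {x} x∉ xu = ∈-filter⁺ bs? (∈-allFin x)
            (x∉ , xu , ¬⟶⇒⟵ (x∉ ∘ there ∘ here ∘ sym) (λ vx → no-vu (x , x∉ , vx , xu)))

          -- When no free vertex alone completes a route, every free vertex is dominated by both `u`
          -- and `v` or dominates both.
          cover : allFin n ⊆ core G ++ (as ++ bs)
          cover {x} _ with x ∈? core G | u ⟶? x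
          ... | yes x∈ | _      = ∈-++⁺ˡ x∈
          ... | no x∉  | yes ux = ∈-++⁺ʳ (core G) (∈-++⁺ˡ (⟵u⇒∈as x∉ ux))
          ... | no x∉  | no ¬ux = ∈-++⁺ʳ (core G) (∈-++⁺ʳ as (⟶u⇒∈bs x∉ (¬⟶⇒⟵ (x∉ ∘ here ∘ sym) ¬ux)))

          count : n ≤ 2 + length (inner G) + (length as + length bs)
          count = begin
            n                                               ≡⟨ length-tabulate (λ i → i) ⟨
            length (allFin n)                               ≤⟨ length-⊆ (Unique.allFin⁺ n) cover ⟩
            length (core G ++ (as ++ bs))                   ≡⟨ length-++ (core G) ⟩
            2 + length (inner G) + length (as ++ bs)        ≡⟨ cong (2 + length (inner G) +_) (length-++ as) ⟩
            2 + length (inner G) + (length as + length bs)  ∎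
            where open ≤-Reasoning

          ∃as : ∃[ a ] a ∈ as
          ∃as with ∃-fresh-out u (v ∷ inner G) (<-≤-trans inner<2t (2t≤outdeg u))
          ... | a , ua , a∉ = a , ⟵u⇒∈as (λ { (here refl) → loopless u ua ; (there a∈) → a∉ a∈ }) ua

          ∃bs : ∃[ b ] b ∈ bs
          ∃bs with ∃-fresh-in u (v ∷ inner G) (<-≤-trans inner<2t (2t≤indeg u))
          ... | b , bu , b∉ = b , ⟶u⇒∈bs (λ { (here refl) → loopless u bu ; (there b∈) → b∉ b∈ }) bu

          -- An arc from `as` to `bs` gives a route u a b v. Here `crossing` applies because `bs`
          -- dominates `u` and `v`, and these dominate `as`.
          ∃arc : ∃[ a ] ∃[ b ] a ∈ as × b ∈ bs × a ⟶ b
          ∃arc = crossing {cs = u ∷ v ∷ []}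
            (Unique.filter⁺ as? (Unique.allFin⁺ n)) (Unique.filter⁺ bs? (Unique.allFin⁺ n)) ((u≢v ∷ []) ∷ [] ∷ [])
            (λ (p , q) → asym (proj₁ (proj₂ (∈as p))) (proj₁ (proj₂ (∈bs q))))
            (λ { (p , here refl) → proj₁ (∈as p) (here refl)
               ; (p , there (here refl)) → proj₁ (∈as p) (there (here refl)) })
            (λ { (p , here refl) → proj₁ (∈bs p) (here refl)
               ; (p , there (here refl)) → proj₁ (∈bs p) (there (here refl)) })
            (proj₂ ∃as) (proj₂ ∃bs)
            (λ { (here refl) p → proj₁ (proj₂ (∈as p)) ; (there (here refl)) p → proj₂ (proj₂ (∈as p)) })
            (λ { p (here refl) → proj₁ (proj₂ (∈bs p)) ; p (there (here refl)) → proj₂ (proj₂ (∈bs p)) })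
            (enough count)

          arc-route : ∃[ r ] Good (r ∷ G) × Small r
          arc-route = let a , b , a∈ , b∈ , ab = ∃arc
                          a∉ , ua , _ = ∈as a∈
                          b∉ , _ , bv = ∈bs b∈ in
            (true , a ∷ b ∷ []) ,
            cons good (ua ∷ ab ∷ bv ∷ [-]) ((⟶⇒≢ ab ∷ []) ∷ [] ∷ []) (a∉ ∷ b∉ ∷ []) ,
            s≤s z≤n , ≤-refl

        route-from : Dec (∃[ x ] Free x × u ⟶ x × x ⟶ v) → Dec (∃[ x ] Free x × v ⟶ x × x ⟶ u) →
          ∃[ r ] Good (r ∷ G) × Small r
        route-from (yes (x , x∉ , ux , xv)) _ =
          (true , [ x ]) , cons good (ux ∷ xv ∷ [-]) ([] ∷ []) (x∉ ∷ []) , s≤s z≤n , s≤s z≤n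
        route-from (no _) (yes (x , x∉ , vx , xu)) =
          (false , [ x ]) , cons good (vx ∷ xu ∷ [-]) ([] ∷ []) (x∉ ∷ []) , s≤s z≤n , s≤s z≤n
        route-from (no no-uv) (no no-vu) = arc-route no-uv no-vu

      opaque
        add-route : ∃[ r ] Good (r ∷ G) × Small r
        add-route = route-from (any? λ x → free? x ×-dec (u ⟶? x) ×-dec (x ⟶? v))
                               (any? λ x → free? x ×-dec (v ⟶? x) ×-dec (x ⟶? u))

    opaque
      -- Each new route has one or two inner vertices, which maintains the bound that `add-route`
      -- needs. The inclusion `G ⊆ H` keeps a prescribed first route available.
      grow : ∀ m {G} → Good G → length (inner G) ≤ 2 * length G → All Nonempty G → length G + m ≤ t →
        ∃[ H ] Good H × All Nonempty H × length H ≡ length G + m × G ⊆ H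
      grow zero {G} good small nonempty _ =
        G , good , nonempty , sym (+-identityʳ (length G)) , (λ r∈ → r∈)
      grow (suc m) {G} good small nonempty ≤t
        with add-route good small (≤-trans (≤-trans (s≤s (m≤m+n (length G) m)) (≤-reflexive (sym (+-suc (length G) m)))) ≤t)
      ... | (d , l) , good′ , ne , l≤2
        with grow m good′
               (≤-trans (≤-reflexive (length-++ l)) (≤-trans (+-mono-≤ l≤2 small) (≤-reflexive (sym (*-suc 2 (length G))))))
               (ne ∷ nonempty) (subst (_≤ t) (+-suc (length G) m) ≤t)
      ...   | H , goodH , neH , len , G⊆H =
        H , goodH , neH , trans len (sym (+-suc (length G) m)) , G⊆H ∘ there

    finish : ∀ {d G} → Good ((d , []) ∷ G) → All Nonempty G → Attached ((d , []) ∷ G) →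
      WeakContainer (suc (length G)) u v
    finish good nonempty att
      with Saturation.saturate (∈-allFin u)
             (strong-upto-2 (Unique.allFin⁺ n)
               (≤-trans (≤-reflexive (sym (length-tabulate (λ i → i)))) (m≤n+m _ 2)))
             good att
    ... | r ∷ H , goodH , _ ∷ G≼H , spans =
      subst (λ m → WeakContainer (suc m) u v) (sym (Pointwise.Pointwise-length G≼H))
        (container goodH spans (nonempty-≼ nonempty G≼H))
      where
      nonempty-≼ : ∀ {G H} → All Nonempty G → G ≼ H → All Nonempty H
      nonempty-≼ []         []                = []
      nonempty-≼ (ne ∷ nes) ((_ , le) ∷ G≼H) = ≤-trans ne le ∷ nonempty-≼ nes G≼H

    arc : ∃[ d ] src d ⟶ tgt d
    arc with tour u v u≢v
    ... | inj₁ (uv , _) = true , uv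
    ... | inj₂ (vu , _) = false , vu

    backward : ∀ d {x} → tgt d ⟶ x → x ⟶ src d → Valid (not d , [ x ]) × x ∉ u ∷ v ∷ []
    backward true  vx xu = (vx ∷ xu ∷ [-]) ,
      λ { (here refl) → ⟶⇒≢ xu refl ; (there (here refl)) → ⟶⇒≢ vx refl }
    backward false ux xv = (ux ∷ xv ∷ [-]) ,
      λ { (here refl) → ⟶⇒≢ ux refl ; (there (here refl)) → ⟶⇒≢ xv refl }

    ≢src : ∀ d {x} → x ≢ u → x ≢ v → x ≢ src d
    ≢src true  x≢u x≢v = x≢u
    ≢src false x≢u x≢v = x≢v

    tgt-not : ∀ d → tgt (not d) ≡ src d
    tgt-not true  = refl
    tgt-not false = refl

    no-routes : Good []
    no-routes = record { valid = [] ; unique = [] ; fits = [] }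

    with-arc : ∀ {d G} → src d ⟶ tgt d → Good G → Good ((d , []) ∷ G)
    with-arc st good = cons good (st ∷ [-]) [] []

    -- If some x has e ⟶ x ⟶ s, where s ⟶ e is the arc between u and v, then the
    -- family starts with e x s and has routes in both directions; otherwise
    -- every vertex is attached to the arc itself.
    weakContainer : ∀ m → suc m ≤ t → WeakContainer (suc (suc m)) u v
    weakContainer m m<t with arc
    ... | d , st with any? (λ x → (tgt d ⟶? x) ×-dec (x ⟶? src d))
    ...   | yes (x , tx , xs) with backward d tx xs
    ...     | val , x∉ with grow m (cons no-routes val ([] ∷ []) (x∉ ∷ [])) (s≤s z≤n) (s≤s z≤n ∷ []) m<t
    ...       | H , good , nonempty , len , ⊆H =
      subst (λ m → WeakContainer (suc m) u v) len (finish (with-arc st good) nonempty att)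
      where
      att : Attached ((d , []) ∷ H)
      att {y} _ y≢u y≢v with src d ⟶? y
      ... | yes sy = here (inj₁ sy)
      -- Now `y` dominates the source of the arc, which is the target of the prescribed backward
      -- route.
      ... | no ¬sy = there (lose (⊆H (here refl))
        (inj₂ (subst (y ⟶_) (sym (tgt-not d)) (¬⟶⇒⟵ (≢src d y≢u y≢v ∘ sym) ¬sy))))
    weakContainer m m<t | d , st | no none with grow (suc m) no-routes z≤n [] m<t
    ... | H , good , nonempty , len , _ =
      subst (λ m → WeakContainer (suc m) u v) len (finish (with-arc st good) nonempty att)
      where
      att : Attached ((d , []) ∷ H)
      att {y} _ y≢u y≢v with src d ⟶? y
      ... | yes sy = here (inj₁ sy)
      ... | no ¬sy = here (inj₂ (¬⟶⇒⟵ (≢src (not d) y≢u y≢v ∘ sym)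
        λ ty → none (y , ty , ¬⟶⇒⟵ (≢src d y≢u y≢v ∘ sym) ¬sy)))

  -- Hamiltonian paths between u and v

  module Single where
    open Containers T tour u≢v
    open Insertion T tour

    record Spanning (w : List (Fin n)) : Set where
      field
        unique : Unique w
        avoids : ∀ {x} → x ∈ w → x ≢ u × x ≢ v
        covers : ∀ {x} → x ≢ u → x ≢ v → x ∈ w

    Spanning-resp-↭ : ∀ {w w′} → w ↭ w′ → Spanning w → Spanning w′
    Spanning-resp-↭ w↭ sp = record
      { unique = Unique-resp-↭ w↭ unique
      ; avoids = avoids ∘ ∈-resp-↭ (↭-sym w↭)
      ; covers = λ x≢u x≢v → ∈-resp-↭ w↭ (covers x≢u x≢v)
      }
      where open Spanning sp

    route-container : ∀ r → Valid r → Spanning (proj₂ r) → WeakContainer 1 u v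
    route-container (d , l) val sp = container
      (record
        { valid  = val ∷ []
        ; unique = subst Unique (sym (++-identityʳ l)) unique
        ; fits   = All.++⁺ (All.tabulate λ x∈ → ∈-allFin _ , avoids x∈) [] })
      (λ {x} _ → spans x) []
      where
      open Spanning sp
      spans : ∀ x → x ∈ u ∷ v ∷ l ++ []
      spans x with x ≟ u | x ≟ v
      ... | yes refl | _        = here refl
      ... | no _     | yes refl = there (here refl)
      ... | no x≢u   | no x≢v   = there (there (∈-++⁺ˡ (covers x≢u x≢v)))

    -- The condition under which a path from `a` to `b` through all vertices but `u` and `v` extends
    -- to a path between `u` and `v`.
    Ends : Fin n → Fin n → Set
    Ends a b = (u ⟶ a × b ⟶ v) ⊎ (v ⟶ a × b ⟶ u)

    join : ∀ {a m b} → Linked _⟶_ (a ∷ m ++ [ b ]) → Spanning (a ∷ m ++ [ b ]) → Ends a b → WeakContainer 1 u v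
    join {a} {m} links sp (inj₁ (ua , bv)) = route-container (true , _) (ua ∷ linked-∷ʳ (a ∷ m) links bv) sp
    join {a} {m} links sp (inj₂ (va , bu)) = route-container (false , _) (va ∷ linked-∷ʳ (a ∷ m) links bu) sp

    record Cycle (x : Fin n) (l : List (Fin n)) : Set where
      field
        closed   : Linked _⟶_ (x ∷ l ++ [ x ])
        spanning : Spanning (x ∷ l)

    others : List (Fin n)
    others = filter (λ x → ¬? (x ∈? u ∷ v ∷ [])) (allFin n)

    ∈-others : ∀ {x} → x ∉ u ∷ v ∷ [] → x ∈ others
    ∈-others x∉ = ∈-filter⁺ (λ x → ¬? (x ∈? u ∷ v ∷ [])) (∈-allFin _) x∉

    ∉-ends : ∀ {x} → x ≢ u → x ≢ v → x ∉ u ∷ v ∷ []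
    ∉-ends x≢u x≢v (here eq)         = x≢u eq
    ∉-ends x≢u x≢v (there (here eq)) = x≢v eq

    others-avoids : ∀ {x} → x ∈ others → x ≢ u × x ≢ v
    others-avoids x∈ with proj₂ (∈-filter⁻ (λ x → ¬? (x ∈? u ∷ v ∷ [])) {xs = allFin n} x∈)
    ... | x∉ = x∉ ∘ here , x∉ ∘ there ∘ here

    unique-others : Unique others
    unique-others = Unique.filter⁺ _ (Unique.allFin⁺ n)

    length-others : n ≤ 2 + length others
    length-others = subst (_≤ 2 + length others) (length-tabulate (λ i → i)) (length-⊆ (Unique.allFin⁺ n) cover)
      where
      cover : allFin n ⊆ u ∷ v ∷ others
      cover {x} _ with x ∈? u ∷ v ∷ []
      ... | yes x∈ = ∈-++⁺ˡ x∈
      ... | no  x∉ = there (there (∈-others x∉))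

    strong-others : Strong others
    strong-others = strong-upto-2 unique-others length-others

    3<outdeg : ∀ x → 3 < outdeg x
    3<outdeg x = ≤-trans 4≤2t (2t≤outdeg x)

    out-neighbour : ∀ x → ∃[ y ] x ⟶ y × y ∉ u ∷ v ∷ []
    out-neighbour x = ∃-fresh-out x (u ∷ v ∷ []) (<-trans (n<1+n 2) (3<outdeg x))

    in-neighbour : ∀ x → ∃[ y ] y ⟶ x × y ∉ u ∷ v ∷ []
    in-neighbour x = ∃-fresh-in x (u ∷ v ∷ []) (<-trans (n<1+n 2) (≤-trans 4≤2t (2t≤indeg x)))

    opaque
      ∃-cycle : ∃[ x ] ∃[ l ] Cycle x l
      ∃-cycle with out-neighbour u
      ... | c , _ , c∉ with out-neighbour c
      -- Some arc `a ⟶ b` leaves the out-neighbourhood of `c`. Since `c ⟶ a`, its head `b` is not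
      -- `c`, so `b ⟶ c` closes a triangle.
      ...   | y , cy , y∉ with strong-others (c ⟶?_) (∈-others y∉) cy (∈-others c∉) (loopless c)
      ...     | a , b , (a∈ , ca) , (b∈ , ¬cb) , ab = enlarge
        where
        -- With equal ends a route is a cycle through `c`, so absorption makes the triangle a
        -- Hamiltonian cycle of `others`.
        module R = Routes T tour others c c

        c≢b : c ≢ b
        c≢b refl = asym ca ab

        triangle : R.Good [ (true , a ∷ b ∷ []) ]
        triangle = record
          { valid  = (ca ∷ ab ∷ ¬⟶⇒⟵ c≢b ¬cb ∷ [-]) ∷ []
          ; unique = (⟶⇒≢ ab ∷ []) ∷ [] ∷ []
          ; fits   = (a∈ , ⟶⇒≢ ca ∘ sym , ⟶⇒≢ ca ∘ sym) ∷ (b∈ , c≢b ∘ sym , c≢b ∘ sym) ∷ []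
          }

        attached : R.Attached [ (true , a ∷ b ∷ []) ]
        attached {x} _ x≢c _ with c ⟶? x
        ... | yes cx = here (inj₁ cx)
        ... | no ¬cx = here (inj₂ (¬⟶⇒⟵ (x≢c ∘ sym) ¬cx))

        enlarge : ∃[ x ] ∃[ l ] Cycle x l
        enlarge with R.Saturation.saturate (∈-others c∉) strong-others triangle attached
        ... | (.true , l) ∷ [] , good , (refl , _) ∷ [] , spans = c , l , record
          { closed   = All.head (R.Good.valid good)
          ; spanning = record
            { unique = All.tabulate (λ x∈ → proj₁ (proj₂ (fits x∈)) ∘ sym) ∷
                       subst Unique (++-identityʳ l) (R.Good.unique good)
            ; avoids = λ { (here refl) → c∉ ∘ here , c∉ ∘ there ∘ here
                         ; (there x∈) → others-avoids (proj₁ (fits x∈)) }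
            ; covers = λ x≢u x≢v → covers′ (spans (∈-others (∉-ends x≢u x≢v)))
            }
          }
          where
          fits : ∀ {x} → x ∈ l → x ∈ others × x ≢ c × x ≢ c
          fits x∈ = All.lookup (R.Good.fits good) (∈-++⁺ˡ x∈)
          covers′ : ∀ {x} → x ∈ c ∷ c ∷ l ++ [] → x ∈ c ∷ l
          covers′ (here eq)         = here eq
          covers′ (there (here eq)) = here eq
          covers′ (there (there x∈)) with ∈-++⁻ l x∈
          ... | inj₁ x∈l = there x∈l

    rotate : ∀ {x y l} → Cycle x (y ∷ l) → Cycle y (l ++ [ x ])
    rotate {x} {y} {l} cyc with Cycle.closed cyc
    ... | xy ∷ rest = record
      { closed   = linked-∷ʳ (y ∷ l) rest xy
      ; spanning = Spanning-resp-↭ (++-comm [ x ] (y ∷ l)) (Cycle.spanning cyc)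
      }

    rotate-to : ∀ {x y l} → Cycle x l → y ∈ x ∷ l → ∃[ l′ ] Cycle y l′
    rotate-to {l = l} cyc (here refl) = l , cyc
    rotate-to cyc (there y∈) with ∈-∃++ y∈
    ... | pre , post , refl = go pre post cyc
      where
      go : ∀ {x y} pre post → Cycle x (pre ++ y ∷ post) → ∃[ l′ ] Cycle y l′
      go []        post cyc = _ , rotate cyc
      go {x} {y} (z ∷ pre) post cyc =
        go pre (post ++ [ x ]) (subst (Cycle z) (++-assoc pre (y ∷ post) [ x ]) (rotate cyc))

    -- What is known of consecutive `a`, `b` on the cycle when the path obtained by cutting between
    -- them cannot be completed.
    Alternates : Fin n → Fin n → Set
    Alternates a b = (a ⟶ v → b ⟶ u) × (a ⟶ u → b ⟶ v)

    -- Cutting the cycle before b gives a Hamiltonian path from b to a avoiding u and v.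
    cut : ∀ a b → b ≢ u → b ≢ v → Ends b a ⊎ Alternates a b
    cut a b b≢u b≢v with u ⟶? b | v ⟶? b | a ⟶? v | a ⟶? u
    ... | yes ub | _      | yes av | _      = inj₁ (inj₁ (ub , av))
    ... | _      | yes vb | _      | yes au = inj₁ (inj₂ (vb , au))
    ... | no ¬ub | no ¬vb | _      | _      = inj₂ ((λ _ → ¬⟶⇒⟵ (b≢u ∘ sym) ¬ub) , (λ _ → ¬⟶⇒⟵ (b≢v ∘ sym) ¬vb))
    ... | no ¬ub | yes _  | _      | no ¬au = inj₂ ((λ _ → ¬⟶⇒⟵ (b≢u ∘ sym) ¬ub) , ⊥-elim ∘ ¬au)
    ... | yes _  | no ¬vb | no ¬av | _      = inj₂ (⊥-elim ∘ ¬av , λ _ → ¬⟶⇒⟵ (b≢v ∘ sym) ¬vb)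
    ... | yes _  | yes _  | no ¬av | no ¬au = inj₂ (⊥-elim ∘ ¬av , ⊥-elim ∘ ¬au)

    opaque
      -- The cut moves along the cycle: `post` lists the vertices before which it is still to be
      -- tried, `pre` those already rotated to the back.
      walk : ∀ x post pre → Cycle x (post ++ pre) → WeakContainer 1 u v ⊎ Linked Alternates (x ∷ post)
      walk x []         pre cyc = inj₂ [-]
      walk x (y ∷ post) pre cyc with Spanning.avoids (Cycle.spanning cyc) (there (here refl))
      ... | y≢u , y≢v with cut x y y≢u y≢v | rotate cyc
      ...   | inj₁ ends | cyc′ = inj₁ (join (Linked.tail (Cycle.closed cyc)) (Cycle.spanning cyc′) ends)
      ...   | inj₂ alt  | cyc′ with walk y post (pre ++ [ x ]) (subst (Cycle y) (++-assoc post pre [ x ]) cyc′)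
      ...     | inj₁ found = inj₁ found
      ...     | inj₂ alts  = inj₂ (alt ∷ alts)

    -- Rotating the cycle to start at `y` lets the property travel from `y` to every vertex.
    closed-class : ∀ {P : Fin n → Set} {x y l} → (∀ {a b} → Alternates a b → P a → P b) →
      Cycle x l → y ∈ x ∷ l → P y → WeakContainer 1 u v ⊎ (∀ {z} → z ∈ x ∷ l → P z)
    closed-class step cyc y∈ py with rotate-to cyc y∈
    ... | l′ , cyc′ with walk _ l′ [] (subst (Cycle _) (sym (++-identityʳ l′)) cyc′)
    ...   | inj₁ found = inj₁ found
    ...   | inj₂ alts  = inj₂ λ z∈ → All.lookup (propagate (Linked.map step alts) py)
      (let (z≢u , z≢v) = Spanning.avoids (Cycle.spanning cyc) z∈ in Spanning.covers (Cycle.spanning cyc′) z≢u z≢v)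

    Mixed : Fin n → Set
    Mixed x = (u ⟶ x × x ⟶ v) ⊎ (v ⟶ x × x ⟶ u)

    opaque
      -- An in-neighbour of `u` spreads the property of dominating `u` or `v` to the whole cycle. A
      -- vertex dominating both would spread that too, contradicting that `u` has an out-neighbour
      -- on the cycle.
      all-mixed : ∀ {x l} → Cycle x l → WeakContainer 1 u v ⊎ (∀ {z} → z ∈ x ∷ l → Mixed z)
      all-mixed {x} {l} cyc with in-neighbour u
      ... | y , yu , y∉
        with closed-class {P = λ z → z ⟶ u ⊎ z ⟶ v}
               (λ { (_ , f) (inj₁ au) → inj₂ (f au) ; (f , _) (inj₂ av) → inj₁ (f av) }) cyc
               (Spanning.covers (Cycle.spanning cyc) (y∉ ∘ here) (y∉ ∘ there ∘ here)) (inj₁ yu)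
      ... | inj₁ found = inj₁ found
      ... | inj₂ some
        with Any.any? (λ z → (z ⟶? u) ×-dec (z ⟶? v)) (x ∷ l)
      ... | no none = inj₂ mixed
        where
        mixed : ∀ {z} → z ∈ x ∷ l → Mixed z
        mixed z∈ with some z∈ | Spanning.avoids (Cycle.spanning cyc) z∈
        ... | inj₁ zu | _ , z≢v = inj₂ (¬⟶⇒⟵ z≢v (λ zv → none (lose z∈ (zu , zv))) , zu)
        ... | inj₂ zv | z≢u , _ = inj₁ (¬⟶⇒⟵ z≢u (λ zu → none (lose z∈ (zu , zv))) , zv)
      ... | yes found with find found
      ...   | z , z∈ , both
        with closed-class {P = λ z → z ⟶ u × z ⟶ v} (λ (f , g) (au , av) → f av , g au) cyc z∈ both
      ...     | inj₁ done = inj₁ done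
      ...     | inj₂ all with out-neighbour u
      ...       | w , uw , w∉ = ⊥-elim (asym uw
        (proj₁ (all (Spanning.covers (Cycle.spanning cyc) (w∉ ∘ here) (w∉ ∘ there ∘ here)))))

    -- The two mixed types alternate, so vertices two apart have the same type and may be the ends
    -- of a path in either order.
    ends-two-apart : ∀ {a b c} → Alternates a b → Alternates b c → Mixed a → Mixed c → Ends a c × Ends c a
    ends-two-apart _ _ (inj₁ (ua , av)) (inj₁ (uc , cv)) = inj₁ (ua , cv) , inj₁ (uc , av)
    ends-two-apart _ _ (inj₂ (va , au)) (inj₂ (vc , cu)) = inj₂ (va , cu) , inj₂ (vc , au)
    ends-two-apart (f , _) (_ , g) (inj₁ (_ , av)) (inj₂ (vc , _)) = ⊥-elim (asym vc (g (f av)))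
    ends-two-apart (_ , f) (g , _) (inj₂ (_ , au)) (inj₁ (uc , _)) = ⊥-elim (asym uc (g (f au)))

    opaque
      -- Deleting `y` leaves a path from `z` to `x` with suitable ends, and inserting `y` between
      -- them keeps these ends.
      reinsert : ∀ {x y z l} → Cycle x (y ∷ z ∷ l) → Ends z x →
        WeakContainer 1 u v ⊎ Linked (λ a b → a ⟶ y → b ⟶ y) (z ∷ l ++ [ x ])
      reinsert {x} {y} {z} {l} cyc ends with rotate cyc
      ... | cyc′ with insert y z l x (Unique.Unique[x∷xs]⇒x∉xs (Spanning.unique (Cycle.spanning cyc′)))
                        (Linked.tail (Linked.tail (Cycle.closed cyc)))
      ...   | inj₂ stuck = inj₂ stuck
      ...   | inj₁ (l′ , links , l′↭) = inj₁ (join links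
        (Spanning-resp-↭ (↭-trans (↭-swap y z ↭-refl) (↭-prep z (++⁺ʳ [ x ] (↭-sym l′↭)))) (Cycle.spanning cyc′)) ends)

    -- The witness is the one of `u` and `v` that `y` dominates.
    mixed-target : ∀ {y} → Mixed y → ∃[ e ] (∀ {z} → y ⟶ z → z ≢ e → z ≢ u × z ≢ v)
    mixed-target {y} (inj₁ (uy , yv)) = v , λ yz z≢v → (λ { refl → asym uy yz }) , z≢v
    mixed-target {y} (inj₂ (vy , yu)) = u , λ yz z≢u → z≢u , (λ { refl → asym vy yz })

    -- The out-neighbours of y other than u and v form an initial segment of the
    -- cycle after y, and there are at least three of them.
    skip : ∀ {x y b l} zs → length zs ≤ 2 → Cycle x (y ∷ zs ++ b ∷ l) → Mixed y →
      Linked (λ a b → a ⟶ y → b ⟶ y) (zs ++ b ∷ l ++ [ x ]) → y ⟶ b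
    skip {x} {y} {b} {l} zs zs≤2 cyc mixed stuck with y ⟶? b
    ... | yes yb = yb
    ... | no ¬yb with mixed-target mixed
    -- At most three vertices are blocked and `y` has at least four out-neighbours. As `w` is not
    -- `e`, it lies on the cycle; but if `b ⟶ y`, everything from `b` onwards dominates `y`.
    ...   | e , target with ∃-fresh-out y (e ∷ zs) (≤-<-trans (s≤s zs≤2) (3<outdeg y))
    ...     | w , yw , w∉ with target yw (w∉ ∘ here)
    ...       | w≢u , w≢v = ⊥-elim (dominated (covers w≢u w≢v))
      where
      open Spanning (Cycle.spanning cyc)
      b⟶y : b ⟶ y
      b⟶y = ¬⟶⇒⟵ (λ { refl → Unique.Unique[x∷xs]⇒x∉xs (AllPairs.tail unique) (∈-++⁺ʳ zs (here refl)) }) ¬yb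
      below : All (_⟶ y) (b ∷ l ++ [ x ])
      below = propagate (linked-++⁻ʳ zs stuck) b⟶y
      dominated : w ∈ x ∷ y ∷ zs ++ b ∷ l → ⊥
      dominated (here refl)         = asym yw (All.lookup below (∈-++⁺ʳ (b ∷ l) (here refl)))
      dominated (there (here refl)) = loopless y yw
      dominated (there (there w∈)) with ∈-++⁻ zs w∈
      ... | inj₁ w∈zs = w∉ (there w∈zs)
      ... | inj₂ w∈bl = asym yw (All.lookup below (∈-++⁺ˡ w∈bl))

    -- One new arc bypasses `a₂` and the other bypasses `a₃` and `a₄`, which frees these to become
    -- the start and the final stretch of the path.
    shortcut : ∀ {a₀ a₁ a₂ a₃ a₄ a₅ l} → Cycle a₀ (a₁ ∷ a₂ ∷ a₃ ∷ a₄ ∷ a₅ ∷ l) →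
      a₁ ⟶ a₃ → a₂ ⟶ a₅ → Ends a₂ a₄ → WeakContainer 1 u v
    shortcut {a₀} {a₁} {a₂} {a₃} {a₄} {a₅} {l} cyc a₁a₃ a₂a₅ ends with Cycle.closed cyc
    ... | a₀a₁ ∷ _ ∷ _ ∷ a₃a₄ ∷ _ ∷ links = join
      {m = ((a₅ ∷ l ++ [ a₀ ]) ++ [ a₁ ]) ++ [ a₃ ]}
      (a₂a₅ ∷ linked-∷ʳ ((a₅ ∷ l ++ [ a₀ ]) ++ [ a₁ ]) (linked-∷ʳ (a₅ ∷ l ++ [ a₀ ]) (linked-∷ʳ (a₅ ∷ l) links a₀a₁) a₁a₃) a₃a₄)
      (Spanning-resp-↭ perm (Cycle.spanning cyc)) ends
      where
      flatten : a₅ ∷ l ++ (a₀ ∷ a₁ ∷ a₃ ∷ a₄ ∷ []) ≡ (((a₅ ∷ l ++ [ a₀ ]) ++ [ a₁ ]) ++ [ a₃ ]) ++ [ a₄ ]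
      flatten = sym (trans (++-assoc ((a₅ ∷ l ++ [ a₀ ]) ++ [ a₁ ]) [ a₃ ] [ a₄ ])
        (trans (++-assoc (a₅ ∷ l ++ [ a₀ ]) [ a₁ ] (a₃ ∷ a₄ ∷ [])) (++-assoc (a₅ ∷ l) [ a₀ ] (a₁ ∷ a₃ ∷ a₄ ∷ []))))
      perm : a₀ ∷ a₁ ∷ a₂ ∷ a₃ ∷ a₄ ∷ a₅ ∷ l ↭ a₂ ∷ (((a₅ ∷ l ++ [ a₀ ]) ++ [ a₁ ]) ++ [ a₃ ]) ++ [ a₄ ]
      perm = ↭-trans (↭-trans (↭-prep a₀ (↭-swap a₁ a₂ ↭-refl)) (↭-swap a₀ a₂ ↭-refl))
        (↭-prep a₂ (↭-trans (++-comm (a₀ ∷ a₁ ∷ a₃ ∷ a₄ ∷ []) (a₅ ∷ l)) (↭-reflexive flatten)))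

    from-cycle : ∀ {x l} → Cycle x l → 5 ≤ length l → WeakContainer 1 u v
    from-cycle {a₀} {l@(a₁ ∷ a₂ ∷ a₃ ∷ a₄ ∷ a₅ ∷ _)} cyc _
      with all-mixed cyc | walk a₀ l [] (subst (Cycle a₀) (sym (++-identityʳ l)) cyc)
    ... | inj₁ found | _          = found
    ... | inj₂ _     | inj₁ found = found
    ... | inj₂ mixed | inj₂ (alt₀₁ ∷ alt₁₂ ∷ alt₂₃ ∷ alt₃₄ ∷ _)
      with reinsert cyc (proj₂ (ends-two-apart alt₀₁ alt₁₂ mixed₀ mixed₂))
         | reinsert (rotate cyc) (proj₂ (ends-two-apart alt₁₂ alt₂₃ mixed₁ mixed₃))
      where
      mixed₀ = mixed (here refl)
      mixed₁ = mixed (there (here refl))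
      mixed₂ = mixed (there (there (here refl)))
      mixed₃ = mixed (there (there (there (here refl))))
    ...   | inj₁ found  | _           = found
    ...   | inj₂ _      | inj₁ found  = found
    -- `a₃` is the second vertex after `a₁` and `a₅` the third after `a₂`, both within the
    -- guaranteed segments of out-neighbours.
    ...   | inj₂ stuck₁ | inj₂ stuck₂ = shortcut cyc
      (skip [ a₂ ] (s≤s z≤n) cyc (mixed (there (here refl))) stuck₁)
      (skip (a₃ ∷ a₄ ∷ []) ≤-refl (rotate cyc) (mixed (there (there (here refl)))) stuck₂)
      (proj₁ (ends-two-apart alt₂₃ alt₃₄ (mixed (there (there (here refl))))
        (mixed (there (there (there (there (here refl))))))))
    from-cycle {l = []}                    _ ()
    from-cycle {l = _ ∷ []}                _ (s≤s ())
    from-cycle {l = _ ∷ _ ∷ []}            _ (s≤s (s≤s ()))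
    from-cycle {l = _ ∷ _ ∷ _ ∷ []}        _ (s≤s (s≤s (s≤s ())))
    from-cycle {l = _ ∷ _ ∷ _ ∷ _ ∷ []}    _ (s≤s (s≤s (s≤s (s≤s ()))))

    weakContainer : WeakContainer 1 u v
    weakContainer with ∃-cycle
    -- The cycle has n - 2 vertices, so 8 ≤ n provides the six that are named `a₀` to `a₅`.
    ... | x , l , cyc = from-cycle cyc (s≤s⁻¹ (s≤s⁻¹ (s≤s⁻¹ (begin
      8                         ≤⟨ n≤1+n 8 ⟩
      9                         ≤⟨ m≤n+m 9 (5 * k) ⟩
      5 * k + 9                 ≤⟨ 5k+9≤n ⟩
      n                         ≤⟨ length-others ⟩
      2 + length others         ≤⟨ +-monoʳ-≤ 2 (length-⊆ unique-others covered) ⟩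
      3 + length l              ∎))))
      where
      open ≤-Reasoning
      covered : others ⊆ x ∷ l
      covered y∈ = let y≢u , y≢v = others-avoids y∈ in Spanning.covers (Cycle.spanning cyc) y≢u y≢v

-- Decidability and existence of the weak spanning connectivity

module _ {A : Set} (xs : List A) where

  -- `resp` replaces function extensionality when a function is rebuilt from its first value and the
  -- rest.
  ∃-function? : ∀ m {P : (Fin m → A) → Set} → (∀ {f g} → f ≗ g → P f → P g) → Decidable P →
    Dec (∃[ f ] (∀ i → f i ∈ xs) × P f)
  ∃-function? zero resp P? =
    map′ (λ p → empty , (λ ()) , p) (λ (_ , _ , p) → resp (λ ()) p) (P? empty)
    where
    empty : Fin 0 → A
    empty ()
  ∃-function? (suc m) {P} resp P? = map′ to from
    (Any.any? (λ x → ∃-function? m (λ f≗g → resp λ { zero → refl ; (suc i) → f≗g i }) (P? ∘ (x Functional.∷_))) xs)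
    where
    to : Any (λ x → ∃[ f ] (∀ i → f i ∈ xs) × P (x Functional.∷ f)) xs → ∃[ f ] (∀ i → f i ∈ xs) × P f
    to found = let x , x∈ , f , f∈ , p = find found in
      x Functional.∷ f , (λ { zero → x∈ ; (suc i) → f∈ i }) , p
    from : ∃[ f ] (∀ i → f i ∈ xs) × P f → Any (λ x → ∃[ f ] (∀ i → f i ∈ xs) × P (x Functional.∷ f)) xs
    from (f , f∈ , p) = lose (f∈ zero)
      (f ∘ suc , f∈ ∘ suc , resp (λ { zero → refl ; (suc i) → refl }) p)

module Decidability {n : ℕ} (T : Digraph n) where
  open Digraph T

  listsUpTo : ℕ → List (List (Fin n))
  listsUpTo zero    = [ [] ]
  listsUpTo (suc m) = [] ∷ cartesianProductWith _∷_ (allFin n) (listsUpTo m)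

  ∈-listsUpTo : ∀ m p → length p ≤ m → p ∈ listsUpTo m
  ∈-listsUpTo zero    []      _  = here refl
  ∈-listsUpTo (suc m) []      _  = here refl
  ∈-listsUpTo (suc m) (x ∷ p) le =
    there (∈-cartesianProductWith⁺ _∷_ (∈-allFin x) (∈-listsUpTo m p (s≤s⁻¹ le)))

  simple∈lists : ∀ {p} → Unique p → p ∈ listsUpTo n
  simple∈lists {p} uniq = ∈-listsUpTo n p
    (subst (length p ≤_) (length-tabulate (λ i → i)) (length-⊆ uniq (λ _ → ∈-allFin _)))

  isPath? : ∀ u v p → Dec (IsPath u v p)
  isPath? u v p = map′
    (λ (s , e , a , u) → record { starts = s ; ends = e ; arcs = a ; simple = u })
    (λ path → let open IsPath path in starts , ends , arcs , simple)
    (Maybe.≡-dec _≟_ (head p) (just u) ×-dec Maybe.≡-dec _≟_ (last p) (just v)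
      ×-dec linked? _⟶?_ p ×-dec DecUnique.unique? _≟_ p)

  module _ {m : ℕ} (u v : Fin n) where

    -- The conditions of `WeakContainer` as a predicate on the family of paths, so that families can
    -- be enumerated.
    IsContainer : (Fin m → List (Fin n)) → Set
    IsContainer f =
      (∀ i → IsPath u v (f i) ⊎ IsPath v u (f i))
      × (∀ i j → f i ≡ f j → i ≡ j)
      × (∀ i j → i ≢ j → ∀ x → x ∈ f i → x ∈ f j → x ≡ u ⊎ x ≡ v)
      × (∀ x → ∃[ i ] x ∈ f i)

    isContainer? : Decidable IsContainer
    isContainer? f =
      all? (λ i → isPath? u v (f i) ⊎-dec isPath? v u (f i))
      ×-dec all? (λ i → all? λ j → List.≡-dec _≟_ (f i) (f j) →-dec (i ≟ j))
      ×-dec all? (λ i → all? λ j → ¬? (i ≟ j) →-dec all? λ x →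
              (x ∈? f i) →-dec ((x ∈? f j) →-dec ((x ≟ u) ⊎-dec (x ≟ v))))
      ×-dec all? (λ x → any? λ i → x ∈? f i)

    isContainer-resp : ∀ {f g} → f ≗ g → IsContainer f → IsContainer g
    isContainer-resp f≗g (paths , dist , disj , span) =
      (λ i → subst (λ p → IsPath u v p ⊎ IsPath v u p) (f≗g i) (paths i)) ,
      (λ i j eq → dist i j (trans (f≗g i) (trans eq (sym (f≗g j))))) ,
      (λ i j i≢j x x∈i x∈j → disj i j i≢j x (subst (x ∈_) (sym (f≗g i)) x∈i) (subst (x ∈_) (sym (f≗g j)) x∈j)) ,
      (λ x → let i , x∈ = span x in i , subst (x ∈_) (f≗g i) x∈)

    path∈lists : (c : WeakContainer m u v) → ∀ i → WeakContainer.path c i ∈ listsUpTo n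
    path∈lists c i with WeakContainer.isPath c i
    ... | inj₁ path = simple∈lists (IsPath.simple path)
    ... | inj₂ path = simple∈lists (IsPath.simple path)

    weakContainer? : Dec (WeakContainer m u v)
    weakContainer? = map′
      (λ (f , _ , paths , dist , disj , span) → record
        { path = f ; isPath = paths ; distinct = dist _ _ ; disjoint = disj ; spanning = span })
      (λ c → let open WeakContainer c in
        path , path∈lists c , isPath , (λ _ _ → distinct) , disjoint , spanning)
      (∃-function? (listsUpTo n) m isContainer-resp isContainer?)

    -- The paths are distinct entries of one finite list; this caps the spanning connectivity.
    container-size : WeakContainer m u v → m ≤ length (listsUpTo n)
    container-size c = subst (_≤ length (listsUpTo n)) (length-tabulate path)
      (length-⊆ (Unique.tabulate⁺ distinct) λ p∈ →
        let i , eq = ∈-tabulate⁻ p∈ in subst (_∈ listsUpTo n) (sym eq) (path∈lists c i))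
      where open WeakContainer c

  weaklyConnected? : ∀ m → Dec (WeaklyConnected m)
  weaklyConnected? m = all? λ u → all? λ v → ¬? (u ≟ v) →-dec weakContainer? u v

  module _ {u v : Fin n} (u≢v : u ≢ v) where

    -- κ is raised as long as the next value is still attained; `fuel` bounds the distance to the
    -- cap given by `container-size`.
    search : ∀ fuel κ → length (listsUpTo n) ≤ fuel + κ → 1 ≤ κ → WeaklyConnectedUpTo κ →
      ∃[ κ′ ] IsWeakSpanningConnectivity κ′ × κ′ ≥ κ
    search fuel κ enough 1≤κ upTo with weaklyConnected? (suc κ)
    ... | no ¬next = κ , record
      { connected₁ = upTo 1 ≤-refl 1≤κ
      ; connected  = upTo
      ; largest    = λ m upToₘ → ≮⇒≥ λ κ<m → ¬next (upToₘ (suc κ) (s≤s z≤n) κ<m)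
      } , ≤-refl
    search zero κ enough 1≤κ upTo | yes next =
      ⊥-elim (<⇒≱ (container-size u v (next u v u≢v)) enough)
    search (suc fuel) κ enough 1≤κ upTo | yes next =
      let κ′ , is , κ′>κ = search fuel (suc κ) (subst (length (listsUpTo n) ≤_) (sym (+-suc fuel κ)) enough) (s≤s z≤n) upTo′
      in κ′ , is , <⇒≤ κ′>κ
      where
      upTo′ : WeaklyConnectedUpTo (suc κ)
      upTo′ ω 1≤ω ω≤ with m≤n⇒m<n∨m≡n ω≤
      ... | inj₁ ω<  = upTo ω 1≤ω (s≤s⁻¹ ω<)
      ... | inj₂ refl = next

    spanningConnectivity≥ : ∀ κ → 1 ≤ κ → WeaklyConnectedUpTo κ →
      ∃[ κ′ ] IsWeakSpanningConnectivity κ′ × κ′ ≥ κ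
    spanningConnectivity≥ κ = search (length (listsUpTo n)) κ (m≤m+n _ κ)

theorem4p3 : (k t n : ℕ) → t ≥ 2 → (T : Digraph n) → Digraph.IsTournament T →
    Digraph.irregularity T ≤ k →
    n ≥ (6 * t + 5 * k) ∸ 3 →
    (∃[ κ ] Digraph.IsWeakSpanningConnectivity T κ × κ ≥ t + 1)
    × (∀ ω → 1 ≤ ω → ω ≤ t + 1 → Digraph.WeaklyConnected T ω)
theorem4p3 k t n 2≤t T tour irr n≥ =
  Decidability.spanningConnectivity≥ T (proj₂ (proj₂ (two-vertices 2≤n))) (t + 1) (m≤n+m 1 t) connected , connected
  where
  open Digraph T using (WeaklyConnectedUpTo)

  -- Moving the 3 across removes the truncated subtraction.
  large : 6 * t + 5 * k ≤ n + 3
  large = ≤-trans (m≤n+m∸n (6 * t + 5 * k) 3) (≤-trans (+-monoʳ-≤ 3 n≥) (≤-reflexive (+-comm 3 n)))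

  -- A pair of distinct vertices is what makes the search for the largest κ terminate.
  2≤n : 2 ≤ n
  2≤n = +-cancelʳ-≤ 3 2 n (begin
    5              ≤⟨ m≤m+n 5 7 ⟩
    6 * 2          ≤⟨ *-monoʳ-≤ 6 2≤t ⟩
    6 * t          ≤⟨ m≤m+n (6 * t) (5 * k) ⟩
    6 * t + 5 * k  ≤⟨ large ⟩
    n + 3          ∎)
    where open ≤-Reasoning

  two-vertices : ∀ {n} → 2 ≤ n → ∃[ u ] ∃[ v ] _≢_ {A = Fin n} u v
  two-vertices (s≤s (s≤s _)) = zero , suc zero , λ ()

  connected : WeaklyConnectedUpTo (t + 1)
  connected (suc zero)    _ _  u v u≢v = Connectivity.Single.weakContainer T tour irr 2≤t large u≢v
  -- Of the m + 2 paths one grows from the arc between `u` and `v`, so m + 1 ≤ t others have to be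
  -- found.
  connected (suc (suc m)) _ ω≤ u v u≢v = Connectivity.Several.weakContainer T tour irr 2≤t large u≢v m
    (s≤s⁻¹ (subst (suc (suc m) ≤_) (+-comm t 1) ω≤))
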